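{- Let $\Psi_{\mathbf{G}}$ be the chromatic symmetric function and $\tilde\Psi$ the augmented chromatic invariant, both extended linearly to the vector space $\mathbf{G}$. Then $\ker\tilde\Psi=\ker\Psi_{\mathbf{G}}$. In particular, for graphs $G_1,G_2$ we have $\Psi_{\mathbf{G}}(G_1)=\Psi_{\mathbf{G}}(G_2)$ if and only if $\tilde\Psi(G_1)=\tilde\Psi(G_2)$.
   Context: $\mathbb{K}$ is a field of characteristic zero, $\mathbb{N}=\{1,2,\dots\}$. $\mathbf{G}=\bigoplus_{n\ge 0}\mathbf{G}_n$, where $\mathbf{G}_n$ is the $\mathbb{K}$-vector space freely generated by the (simple) graphs with vertex set $[n]$. A coloring of $G$ is a function $f:V(G)\to\mathbb{N}$, proper if no edge is monochromatic, and $x_f=\prod_{v\in V(G)}x_{f(v)}$. The chromatic symmetric function is $\Psi_{\mathbf{G}}(G)=\sum_f x_f$ over proper colorings $f$ of $G$, in the commuting variables $x_1,x_2,\dots$. Let $R$ be the ring of formal power series in the commuting variables $x_1,x_2,\dots$ with coefficients in the commutative ring $\mathbb{K}[q_1,q_2,\dots]/\big(q_i(q_i-1)^2 : i\ge1\big)$. The augmented chromatic invariant is $\tilde\Psi(G)=\sum_f x_f\prod_i q_i^{c_G(f,i)}\in R$, where the sum runs over all colorings $f$ of $G$ (not only proper ones) and $c_G(f,i)$ is the number of edges $\{v_1,v_2\}$ of $G$ with $f(v_1)=f(v_2)=i$. -}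

module Defs where

open import Algebra.Apartness.Bundles using (HeytingField; HeytingCommutativeRing)
open import Algebra.Bundles using (CommutativeRing; RawMonoid; RawRing)
import Algebra.Definitions.RawMonoid as RawMonoidDefs
open import Algebra.Module.Bundles using (RawLeftModule)
import Algebra.Module.Construct.TensorUnit as TensorUnit
open import Data.Bool.Base using (Bool; T; if_then_else_)
import Data.Bool.Properties as Bool
open import Data.Fin.Base using (Fin)
open import Data.Fin.Properties using (all?) renaming (_<?_ to _<ᶠ?_)
open import Data.List.Base
  using (List; []; _∷_; _++_; map; foldr; filter; length; upTo; allFin; cartesianProduct; cartesianProductWith)
open import Data.List.Properties using (filter-none)
import Data.List.Relation.Unary.All as All
open import Data.Nat.Base as ℕ using (ℕ; zero; suc; _⊔_; _≤_; _<_)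
import Data.Nat.Properties as ℕ
open import Data.Product.Base using (∃; _×_; _,_)
import Data.Vec.Functional as Vector
open import Function.Base using (_∘_)
open import Level using (Level; 0ℓ) renaming (_⊔_ to _⊔ˡ_)
open import Relation.Binary.Bundles using (DecSetoid)
open import Relation.Binary.Core using (Rel)
open import Relation.Binary.Definitions using (Decidable)
open import Relation.Binary.PropositionalEquality using (_≡_; _≢_; refl; sym; trans; cong; cong₂; subst)
open import Relation.Nullary.Decidable using (yes; no; does; dec-false; map′; ¬?; _×-dec_; _→-dec_; T?)
open import Relation.Nullary.Negation using (¬_)
import Relation.Unary as Pred
open import Relation.Unary using (Pred)
open import Relation.Unary.Properties using (U?)

private
  variable
    a b c ℓ ℓ₁ ℓ₂ m ℓm p : Level
    n : ℕ

------------------------------------------------------------------------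
-- Fields of characteristic zero

CharacteristicZero : HeytingField c ℓ₁ ℓ₂ → Set ℓ₁
CharacteristicZero K = ∀ n → ¬ (suc n · 1# ≈ 0#)
  where
  open HeytingField K using (heytingCommutativeRing)
  open HeytingCommutativeRing heytingCommutativeRing using (commutativeRing)
  open CommutativeRing commutativeRing using (_≈_; 0#; 1#; +-rawMonoid)
  open RawMonoidDefs +-rawMonoid using () renaming (_×_ to _·_)

------------------------------------------------------------------------
-- Graphs

record Graph (n : ℕ) : Set where
  field
    adjacent    : Fin n → Fin n → Bool
    symmetric   : ∀ u v → T (adjacent u v) → T (adjacent v u)
    irreflexive : ∀ v → ¬ T (adjacent v v)

open Graph public

-- The generators of ⊕ₙ 𝐆ₙ are the graphs on [n] for all n ≥ 0.  Graphs
-- are identified when they have the same edges, not up to isomorphism.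

data _≈ᴳ_ : Rel (∃ Graph) 0ℓ where
  same-edges : {G H : Graph n} → (∀ u v → adjacent G u v ≡ adjacent H u v) → (n , G) ≈ᴳ (n , H)

graphs : DecSetoid 0ℓ 0ℓ
graphs = record
  { Carrier = ∃ Graph
  ; _≈_ = _≈ᴳ_
  ; isDecEquivalence = record
    { isEquivalence = record
      { refl  = same-edges λ _ _ → refl
      ; sym   = λ { (same-edges e) → same-edges λ u v → sym (e u v) }
      ; trans = λ { (same-edges e) (same-edges e′) → same-edges λ u v → trans (e u v) (e′ u v) }
      }
    ; _≟_ = dec
    }
  }
  where
  dec : Decidable _≈ᴳ_
  dec (k , G) (l , H) with k ℕ.≟ l
  ... | no k≢l = no λ { (same-edges _) → k≢l refl }
  ... | yes refl = map′ same-edges (λ { (same-edges e) → e })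
                     (all? λ u → all? λ v → adjacent G u v Bool.≟ adjacent H u v)

-- Each edge {u , v} is listed once, as the pair with u < v.

edges : Graph n → List (Fin n × Fin n)
edges {n} G = filter (λ (u , v) → (u <ᶠ? v) ×-dec T? (adjacent G u v))
                     (cartesianProduct (allFin n) (allFin n))

------------------------------------------------------------------------
-- Colourings

-- The colour k : ℕ stands for the positive integer k + 1.

Colouring : ℕ → Set
Colouring n = Fin n → ℕ

Proper : Graph n → Colouring n → Set
Proper G f = ∀ u v → T (adjacent G u v) → f u ≢ f v

proper? : (G : Graph n) → Pred.Decidable (Proper G)
proper? G f = all? λ u → all? λ v → T? (adjacent G u v) →-dec ¬? (f u ℕ.≟ f v)

-- c_G(f , i)

monochromatic : Graph n → Colouring n → ℕ → ℕ
monochromatic G f i = length (filter (λ (u , v) → (f u ℕ.≟ i) ×-dec (f v ℕ.≟ i)) (edges G))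

-- Strictly above every colour used by f.

colourBound : Colouring n → ℕ
colourBound = Vector.foldr (λ k b → suc k ⊔ b) 0

colour<bound : (f : Colouring n) (v : Fin n) → f v < colourBound f
colour<bound f Fin.zero    = ℕ.m≤m⊔n (suc (f Fin.zero)) (colourBound (Vector.tail f))
colour<bound f (Fin.suc v) = ℕ.≤-trans (colour<bound (Vector.tail f) v) (ℕ.m≤n⊔m (suc (f Fin.zero)) _)

-- All f : Fin n → ℕ with every value < N.

colouringsBelow : ℕ → (n : ℕ) → List (Colouring n)
colouringsBelow N zero    = (λ ()) ∷ []
colouringsBelow N (suc n) = cartesianProductWith Vector._∷_ (upTo N) (colouringsBelow N n)

------------------------------------------------------------------------
-- Monomials in countably many commuting variables

record Monomial : Set where
  field
    exponent : ℕ → ℕ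
    bound    : ℕ
    vanishes : ∀ i → bound ≤ i → exponent i ≡ 0

open Monomial public

_≈ᴹᵒ_ : Rel Monomial 0ℓ
x ≈ᴹᵒ y = ∀ i → exponent x i ≡ exponent y i

_≟ᴹᵒ_ : Decidable _≈ᴹᵒ_
x ≟ᴹᵒ y = map′ extend (λ e {i} _ → e i)
               (ℕ.allUpTo? (λ i → exponent x i ℕ.≟ exponent y i) (bound x ⊔ bound y))
  where
  extend : (∀ {i} → i < bound x ⊔ bound y → exponent x i ≡ exponent y i) → x ≈ᴹᵒ y
  extend e i with i ℕ.<? bound x ⊔ bound y
  ... | yes i<b = e i<b
  ... | no  i≮b = trans (vanishes x i (ℕ.≤-trans (ℕ.m≤m⊔n _ _) b≤i))
                        (sym (vanishes y i (ℕ.≤-trans (ℕ.m≤n⊔m (bound x) _) b≤i)))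
    where b≤i = ℕ.≮⇒≥ i≮b

monomials : DecSetoid 0ℓ 0ℓ
monomials = record
  { Carrier = Monomial
  ; _≈_ = _≈ᴹᵒ_
  ; isDecEquivalence = record
    { isEquivalence = record
      { refl  = λ _ → refl
      ; sym   = λ e i → sym (e i)
      ; trans = λ e e′ i → trans (e i) (e′ i)
      }
    ; _≟_ = _≟ᴹᵒ_
    }
  }

monomialMonoid : RawMonoid 0ℓ 0ℓ
monomialMonoid = record
  { Carrier = Monomial
  ; _≈_ = _≈ᴹᵒ_
  ; _∙_ = λ x y → record
    { exponent = λ i → exponent x i ℕ.+ exponent y i
    ; bound    = bound x ⊔ bound y
    ; vanishes = λ i b≤i → cong₂ ℕ._+_
        (vanishes x i (ℕ.≤-trans (ℕ.m≤m⊔n _ _) b≤i))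
        (vanishes y i (ℕ.≤-trans (ℕ.m≤n⊔m (bound x) _) b≤i))
    }
  ; ε = record { exponent = λ _ → 0 ; bound = 0 ; vanishes = λ _ _ → refl }
  }

var : ℕ → Monomial
var i = record
  { exponent = λ j → if does (i ℕ.≟ j) then 1 else 0
  ; bound    = suc i
  ; vanishes = λ j i<j → cong (λ b → if b then 1 else 0) (dec-false (i ℕ.≟ j) (ℕ.<⇒≢ i<j))
  }

-- x_f = ∏_v x_{f(v)}

xᶠ : Colouring n → Monomial
xᶠ f = ∏ (var ∘ f)
  where open RawMonoidDefs monomialMonoid using () renaming (sum to ∏)

-- ∏_i q_i ^ c_G(f , i)

qᶠ : Graph n → Colouring n → Monomial
qᶠ G f = record
  { exponent = monochromatic G f
  ; bound    = colourBound f
  ; vanishes = λ i b≤i → cong length (filter-none _ (All.universal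
      (λ (u , _) (fu≡i , _) → ℕ.<⇒≱ (subst (_< colourBound f) fu≡i (colour<bound f u)) b≤i)
      (edges G)))
  }

------------------------------------------------------------------------
-- Free modules: formal linear combinations, compared by coefficients

module Free (R : RawRing c ℓ) (X : DecSetoid a b) where
  open RawRing R
  open DecSetoid X using (_≟_) renaming (Carrier to Gen)

  Combination : Set _
  Combination = List (Carrier × Gen)

  coeff : Combination → Gen → Carrier
  coeff z x = foldr (λ (k , y) s → (if does (y ≟ x) then k else 0#) + s) 0# z

  freeModule : RawLeftModule Carrier _ _
  freeModule = record
    { Carrierᴹ = Combination
    ; _≈ᴹ_ = λ z w → ∀ x → coeff z x ≈ coeff w x
    ; _+ᴹ_ = _++_
    ; _*ₗ_ = λ k → map λ (l , x) → (k * l , x)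
    ; 0ᴹ   = []
    ; -ᴹ_  = map λ (l , x) → (- l , x)
    }

  linearExtension : (M : RawLeftModule Carrier m ℓm) →
    (Gen → RawLeftModule.Carrierᴹ M) → Combination → RawLeftModule.Carrierᴹ M
  linearExtension M φ = foldr (λ (k , x) s → (k *ₗ φ x) +ᴹ s) 0ᴹ
    where open RawLeftModule M

Ker : {A : Set a} {R : Set c} (M : RawLeftModule R m ℓm) →
      (A → RawLeftModule.Carrierᴹ M) → Pred A ℓm
Ker M φ z = φ z ≈ᴹ 0ᴹ
  where open RawLeftModule M

------------------------------------------------------------------------
-- Ideals generated by a family, and quotient rings

module Quotient (R : RawRing c ℓ) {I : Set a} (g : I → RawRing.Carrier R) where
  open RawRing R

  data Ideal : Pred Carrier (a ⊔ˡ c ⊔ˡ ℓ) where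
    generator : ∀ i → Ideal (g i)
    zero      : Ideal 0#
    add       : ∀ {x y} → Ideal x → Ideal y → Ideal (x + y)
    multiply  : ∀ r {x} → Ideal x → Ideal (r * x)
    respect   : ∀ {x y} → x ≈ y → Ideal x → Ideal y

  quotient : RawRing _ _
  quotient = record
    { Carrier = Carrier
    ; _≈_ = λ x y → Ideal (x + (- y))
    ; _+_ = _+_ ; _*_ = _*_ ; -_ = -_ ; 0# = 0# ; 1# = 1#
    }

------------------------------------------------------------------------

module _ (K : HeytingField c ℓ₁ ℓ₂) where

  private
    𝕂 : RawRing c ℓ₁
    𝕂 = CommutativeRing.rawRing
          (HeytingCommutativeRing.commutativeRing (HeytingField.heytingCommutativeRing K))

    module 𝕂 = RawRing 𝕂
    module 𝐆 = Free 𝕂 graphs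
    module Poly = Free 𝕂 monomials

  -- 𝕂[q₁ , q₂ , …]

  polynomialRing : RawRing _ _
  polynomialRing = record
    { Carrier = Poly.Combination
    ; _≈_ = _≈ᴹ_
    ; _+_ = _+ᴹ_
    ; _*_ = cartesianProductWith λ (k , x) (l , y) → (k 𝕂.* l , x ∙ y)
    ; -_  = -ᴹ_
    ; 0#  = 0ᴹ
    ; 1#  = (𝕂.1# , ε) ∷ []
    }
    where
    open RawLeftModule Poly.freeModule
    open RawMonoid monomialMonoid using (_∙_; ε)

  relator : ℕ → Poly.Combination
  relator i = q * ((q - 1#) * (q - 1#))
    where
    open RawRing polynomialRing
    q = (𝕂.1# , var i) ∷ []
    _-_ : Poly.Combination → Poly.Combination → Poly.Combination
    x - y = x + (- y)

  -- 𝕂[q₁ , q₂ , …] / (qᵢ (qᵢ - 1)² : i ≥ 1)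

  coefficientRing : RawRing _ _
  coefficientRing = Quotient.quotient polynomialRing relator

  coefficientModule : RawLeftModule 𝕂.Carrier _ _
  coefficientModule = record
    { _≈ᴹ_ = _≈_
    ; _+ᴹ_ = _+_
    ; _*ₗ_ = RawLeftModule._*ₗ_ Poly.freeModule
    ; 0ᴹ   = 0#
    ; -ᴹ_  = -_
    }
    where open RawRing coefficientRing

  -- A formal power series in x₁ , x₂ , … is its family of coefficients.
  -- Only the 𝕂-module structure is given: x_f ∏ᵢ qᵢ ^ c_G(f , i) is the
  -- polynomial ∏ᵢ qᵢ ^ c_G(f , i) in the coefficient of the monomial x_f.

  series : RawLeftModule 𝕂.Carrier m ℓm → RawLeftModule 𝕂.Carrier m ℓm
  series A = record
    { Carrierᴹ = Monomial → Carrierᴹ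
    ; _≈ᴹ_ = λ s t → ∀ x → s x ≈ᴹ t x
    ; _+ᴹ_ = λ s t x → s x +ᴹ t x
    ; _*ₗ_ = λ k s x → k *ₗ s x
    ; 0ᴹ   = λ _ → 0ᴹ
    ; -ᴹ_  = λ s x → -ᴹ (s x)
    }
    where open RawLeftModule A

  -- ∑ w(f) x_f over all f : Fin n → ℕ satisfying P.  The coefficient of x
  -- is the sum of w(f) over those f with x_f = x, all of which use only
  -- colours < bound x.

  colouringSum : (A : RawLeftModule 𝕂.Carrier m ℓm) {P : Pred (Colouring n) p} → Pred.Decidable P →
    (Colouring n → RawLeftModule.Carrierᴹ A) → RawLeftModule.Carrierᴹ (series A)
  colouringSum {n = n} A P? w x =
    foldr (λ f s → w f +ᴹ s) 0ᴹ
      (filter (λ f → P? f ×-dec (xᶠ f ≟ᴹᵒ x)) (colouringsBelow (bound x) n))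
    where open RawLeftModule A

  GraphSpace : RawLeftModule 𝕂.Carrier _ _
  GraphSpace = 𝐆.freeModule

  Λ : RawLeftModule 𝕂.Carrier _ _
  Λ = series (TensorUnit.rawLeftModule {R = 𝕂})

  Ψ : Graph n → RawLeftModule.Carrierᴹ Λ
  Ψ G = colouringSum (TensorUnit.rawLeftModule {R = 𝕂}) (proper? G) (λ _ → 𝕂.1#)

  R̃ : RawLeftModule 𝕂.Carrier _ _
  R̃ = series coefficientModule

  Ψ̃ : Graph n → RawLeftModule.Carrierᴹ R̃
  Ψ̃ G = colouringSum coefficientModule U? (λ f → (𝕂.1# , qᶠ G f) ∷ [])

  Ψ-linear : RawLeftModule.Carrierᴹ GraphSpace → RawLeftModule.Carrierᴹ Λ
  Ψ-linear = 𝐆.linearExtension Λ λ (_ , G) → Ψ G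

  Ψ̃-linear : RawLeftModule.Carrierᴹ GraphSpace → RawLeftModule.Carrierᴹ R̃
  Ψ̃-linear = 𝐆.linearExtension R̃ λ (_ , G) → Ψ̃ G

{-# OPTIONS --safe #-}

-- The coefficient of x = ∏ xᵢ^aᵢ in Ψ̃(G) is the convolution, over the colours
-- i, of the set functions S ↦ [|S| = aᵢ] qᵢ^e(S), evaluated at the vertex set;
-- here e(S) is the number of edges of G inside S.  At q = 0 it becomes the
-- coefficient of x in Ψ(G), which gives ker Ψ̃ ⊆ ker Ψ.
--
-- Conversely, modulo q(q - 1)² the power q^e is a combination of 0^e, 1 and e,
-- so Ψ̃(G) is a combination of convolutions of the functions
--   σₐ(S) = [|S| = a][S stable],  sₐ(S) = [|S| = a],  eₐ(S) = [|S| = a] e(S).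
-- As σ₁ ⋆ sₐ = (a + 1) sₐ₊₁, s₂ = σ₂ + e₂ and eₐ₊₂ = e₂ ⋆ sₐ, in characteristic
-- zero all of these are combinations of convolutions of functions σₐ, that is,
-- of coefficients of Ψ(G), with scalars that do not depend on G.

module Submission where

open import Defs
open import Algebra.Apartness.Bundles using (HeytingField; HeytingCommutativeRing)
open import Algebra.Bundles using (CommutativeSemiring; CommutativeRing; RawMonoid; RawRing)
open import Algebra.Core using (Op₂)
import Algebra.Definitions.RawMonoid as RawMonoidDefs
open import Algebra.Module.Bundles using (RawLeftModule)
open import Algebra.Morphism.Structures using (module SemiringMorphisms)
import Algebra.Properties.CommutativeSemigroup as CommutativeSemigroupProperties
import Algebra.Properties.Ring
import Algebra.Properties.Semiring.Exp as Exponentiation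
import Algebra.Properties.Semiring.Mult as Multiplication
open import Data.Bool.Base using (Bool; true; false; T; _∧_; if_then_else_)
open import Data.Bool.Properties using (T-≡; ¬-not; ∧-identityʳ; ∧-zeroʳ)
open import Data.Fin.Base as Fin using (Fin)
import Data.Fin.Properties as Fin
open import Data.List.Base
  using (List; []; _∷_; _++_; map; foldr; filter; length; applyUpTo; allFin; tabulate; cartesianProductWith)
open import Data.List.Membership.Propositional using (_∈_)
open import Data.List.Membership.Propositional.Properties
  using (∈-allFin; ∈-cartesianProductWith⁺; ∈-filter⁺; ∈-filter⁻; ∈-upTo⁻)
open import Data.List.Properties using (filter-none; filter-notAll; ++-assoc; ++-identityʳ)
open import Data.List.Relation.Unary.All as All using (All; []; _∷_)
import Data.List.Relation.Unary.All.Properties as All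
open import Data.List.Relation.Unary.Any using (here)
open import Data.Nat.Base as ℕ using (ℕ; zero; suc; _≤_; _<_)
import Data.Nat.Properties as ℕ
open import Data.Product.Base using (∃; _×_; _,_; proj₁; proj₂)
import Data.Vec.Functional as Vector
open import Function.Base using (_∘_; id)
open import Function.Bundles using (_⇔_; mk⇔; Equivalence)
open import Level using (Level)
open import Relation.Binary.Bundles using (DecSetoid)
open import Relation.Binary.Definitions using (tri<; tri≈; tri>)
open import Relation.Binary.PropositionalEquality as ≡ using (_≡_; _≢_; ≢-sym)
import Relation.Binary.Reasoning.Setoid as ≈-Reasoning
open import Relation.Nullary.Decidable
  using (Dec; does; yes; no; _×-dec_; ¬?; T?; decidable-stable; dec-true; dec-false; does-⇔)
open import Relation.Nullary.Negation using (¬_; contradiction)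
open import Relation.Unary using (_≐_; Decidable)
open import Relation.Unary.Properties using (U?)

-- The hypothesis controls only whole coefficients of Ψ summed over a combination `z`, never a
-- single factor of a convolution or a single graph. The identities between set functions must
-- therefore be applied inside products whose other factors are still present. `Good` is made for
-- this: a family is good if its convolution with every product of stable-set indicators vanishes on
-- `z`, and goodness survives convolution with each of the three functions into which a power of q
-- expands. Starting from the unit, `vanishing` absorbs one colour at a time into a good prefix.
--
-- Sets are represented by lists, and convolution is defined along the list by the Leibniz rule.
-- Every identity between set functions then becomes an induction that removes one vertex, with no
-- subsets to enumerate.

private
  variable
    a b c ℓ p : Level
    X Y Z : Set a
    V : Set
    n : ℕ

-- Colour classes and finite sums.

-- The labelling `vs` is kept apart from `f`, so that the recursion can drop the first vertex and
-- still list the class by its original vertices.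
colourClass : (Fin n → V) → Colouring n → ℕ → List V
colourClass {n = zero}  vs f i = []
colourClass {n = suc n} vs f i =
  if does (f Fin.zero ℕ.≟ i) then vs Fin.zero ∷ rest else rest
  where rest = colourClass (vs ∘ Fin.suc) (f ∘ Fin.suc) i

-- The tail is reached by shifting `ψ`, so the recursions of `∑<`, `∏<`, `⋆<` and of products of
-- monomials run in step.
big : Op₂ X → X → ℕ → (ℕ → X) → X
big _∙_ ε zero    ψ = ε
big _∙_ ε (suc N) ψ = ψ 0 ∙ big _∙_ ε N (ψ ∘ suc)

module Sums (A : CommutativeSemiring c ℓ) where
  open CommutativeSemiring A hiding (zero)
  open CommutativeSemigroupProperties +-commutativeSemigroup using () renaming (interchange to +-interchange)

  ∑ : List X → (X → Carrier) → Carrier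
  ∑ xs φ = foldr (λ x s → φ x + s) 0# xs

  ∑< ∏< : ℕ → (ℕ → Carrier) → Carrier
  ∑< = big _+_ 0#
  ∏< = big _*_ 1#

  ∑-cong-All : {φ ψ : X → Carrier} {xs : List X} → All (λ x → φ x ≈ ψ x) xs → ∑ xs φ ≈ ∑ xs ψ
  ∑-cong-All []       = refl
  ∑-cong-All (e ∷ es) = +-cong e (∑-cong-All es)

  ∑-cong : {φ ψ : X → Carrier} (xs : List X) → (∀ x → φ x ≈ ψ x) → ∑ xs φ ≈ ∑ xs ψ
  ∑-cong xs e = ∑-cong-All (All.universal e xs)

  ∑-zero : {φ : X → Carrier} (xs : List X) → (∀ x → φ x ≈ 0#) → ∑ xs φ ≈ 0#
  ∑-zero []       e = refl
  ∑-zero (x ∷ xs) e = trans (+-cong (e x) (∑-zero xs e)) (+-identityˡ 0#)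

  ∑-+ : (φ ψ : X → Carrier) (xs : List X) → ∑ xs (λ x → φ x + ψ x) ≈ ∑ xs φ + ∑ xs ψ
  ∑-+ φ ψ []       = sym (+-identityˡ 0#)
  ∑-+ φ ψ (x ∷ xs) = trans (+-congˡ (∑-+ φ ψ xs)) (+-interchange _ _ _ _)

  ∑-*ˡ : (k : Carrier) (φ : X → Carrier) (xs : List X) → ∑ xs (λ x → k * φ x) ≈ k * ∑ xs φ
  ∑-*ˡ k φ []       = sym (zeroʳ k)
  ∑-*ˡ k φ (x ∷ xs) = trans (+-congˡ (∑-*ˡ k φ xs)) (sym (distribˡ k _ _))

  ∑-++ : (φ : X → Carrier) (xs ys : List X) → ∑ (xs ++ ys) φ ≈ ∑ xs φ + ∑ ys φ
  ∑-++ φ []       ys = sym (+-identityˡ _)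
  ∑-++ φ (x ∷ xs) ys = trans (+-congˡ (∑-++ φ xs ys)) (sym (+-assoc _ _ _))

  ∑-map : (φ : Y → Carrier) (f : X → Y) (xs : List X) → ∑ (map f xs) φ ≡ ∑ xs (φ ∘ f)
  ∑-map φ f []       = ≡.refl
  ∑-map φ f (x ∷ xs) = ≡.cong (φ (f x) +_) (∑-map φ f xs)

  ∑-cartesianProductWith : (φ : Z → Carrier) (f : X → Y → Z) (xs : List X) (ys : List Y) →
    ∑ (cartesianProductWith f xs ys) φ ≈ ∑ xs (λ x → ∑ ys (λ y → φ (f x y)))
  ∑-cartesianProductWith φ f []       ys = refl
  ∑-cartesianProductWith φ f (x ∷ xs) ys = trans (∑-++ φ (map (f x) ys) _)
    (+-cong (reflexive (∑-map φ (f x) ys)) (∑-cartesianProductWith φ f xs ys))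

  ∑-swap : (φ : X → Y → Carrier) (xs : List X) (ys : List Y) →
    ∑ xs (λ x → ∑ ys (φ x)) ≈ ∑ ys (λ y → ∑ xs (λ x → φ x y))
  ∑-swap φ []       ys = sym (∑-zero ys λ _ → refl)
  ∑-swap φ (x ∷ xs) ys = trans (+-congˡ (∑-swap φ xs ys)) (sym (∑-+ (φ x) _ ys))

  ∑-filter : {P : X → Set p} (P? : Decidable P) (φ : X → Carrier) (xs : List X) →
    ∑ (filter P? xs) φ ≈ ∑ xs (λ x → if does (P? x) then φ x else 0#)
  ∑-filter P? φ []       = refl
  ∑-filter P? φ (x ∷ xs) with does (P? x)
  ... | true  = +-congˡ (∑-filter P? φ xs)
  ... | false = trans (∑-filter P? φ xs) (sym (+-identityˡ _))

  ∑-applyUpTo : (φ : X → Carrier) (g : ℕ → X) (N : ℕ) → ∑ (applyUpTo g N) φ ≡ ∑< N (φ ∘ g)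
  ∑-applyUpTo φ g zero    = ≡.refl
  ∑-applyUpTo φ g (suc N) = ≡.cong (φ (g 0) +_) (∑-applyUpTo φ (g ∘ suc) N)

  ∑<-cong : {φ ψ : ℕ → Carrier} (N : ℕ) → (∀ i → φ i ≈ ψ i) → ∑< N φ ≈ ∑< N ψ
  ∑<-cong zero    e = refl
  ∑<-cong (suc N) e = +-cong (e 0) (∑<-cong N (e ∘ suc))

  ∏<-cong : {φ ψ : ℕ → Carrier} (N : ℕ) → (∀ i → φ i ≈ ψ i) → ∏< N φ ≈ ∏< N ψ
  ∏<-cong zero    e = refl
  ∏<-cong (suc N) e = *-cong (e 0) (∏<-cong N (e ∘ suc))

-- Set functions, on sets enumerated by lists, under the convolution
-- (φ ⋆ ψ)(S) = ∑ φ(T) ψ(U) over the ordered partitions S = T ⊔ U.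

module Convolution (A : CommutativeSemiring c ℓ) where
  open CommutativeSemiring A hiding (zero)
  open import Relation.Binary.Reasoning.Setoid setoid
  open CommutativeSemigroupProperties +-commutativeSemigroup using ()
    renaming (interchange to +-interchange)
  open CommutativeSemigroupProperties *-commutativeSemigroup using (x∙yz≈y∙xz)
  open Multiplication semiring using () renaming (_×_ to _·_)
  open Sums A

  SetFunction : Set → Set c
  SetFunction V = List V → Carrier

  infix 4 _≋_
  _≋_ : SetFunction V → SetFunction V → Set _
  φ ≋ ψ = ∀ S → φ S ≈ ψ S

  infixl 6 _⊕_
  _⊕_ : SetFunction V → SetFunction V → SetFunction V
  (φ ⊕ ψ) S = φ S + ψ S

  infixr 8 _⊙_
  _⊙_ : Carrier → SetFunction V → SetFunction V
  (k ⊙ φ) S = k * φ S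

  ∂ : V → SetFunction V → SetFunction V
  ∂ v φ S = φ (v ∷ S)

  -- ∂ v is a derivation: v lies in T or in U.
  infixl 7 _⋆_
  _⋆_ : SetFunction V → SetFunction V → SetFunction V
  (φ ⋆ ψ) []      = φ [] * ψ []
  (φ ⋆ ψ) (v ∷ S) = (∂ v φ ⋆ ψ) S + (φ ⋆ ∂ v ψ) S

  -- `size 0` is the unit of `⋆`. Removing a vertex lowers the index: `∂ v (size (suc a))` is
  -- `size a` by computation.
  size : ℕ → SetFunction V
  size zero    []      = 1#
  size zero    (_ ∷ _) = 0#
  size (suc a) []      = 0#
  size (suc a) (_ ∷ S) = size a S

  ⋆-cong : {φ φ′ ψ ψ′ : SetFunction V} → φ ≋ φ′ → ψ ≋ ψ′ → φ ⋆ ψ ≋ φ′ ⋆ ψ′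
  ⋆-cong e f []      = *-cong (e []) (f [])
  ⋆-cong e f (v ∷ S) = +-cong (⋆-cong (λ S → e (v ∷ S)) f S) (⋆-cong e (λ S → f (v ∷ S)) S)

  ⋆-distribʳ : (χ φ ψ : SetFunction V) → (φ ⊕ ψ) ⋆ χ ≋ φ ⋆ χ ⊕ ψ ⋆ χ
  ⋆-distribʳ χ φ ψ []      = distribʳ _ _ _
  ⋆-distribʳ χ φ ψ (v ∷ S) =
    trans (+-cong (⋆-distribʳ χ (∂ v φ) (∂ v ψ) S) (⋆-distribʳ (∂ v χ) φ ψ S)) (+-interchange _ _ _ _)

  ⋆-distribˡ : (χ φ ψ : SetFunction V) → χ ⋆ (φ ⊕ ψ) ≋ χ ⋆ φ ⊕ χ ⋆ ψ
  ⋆-distribˡ χ φ ψ []      = distribˡ _ _ _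
  ⋆-distribˡ χ φ ψ (v ∷ S) =
    trans (+-cong (⋆-distribˡ (∂ v χ) φ ψ S) (⋆-distribˡ χ (∂ v φ) (∂ v ψ) S)) (+-interchange _ _ _ _)

  ⋆-zeroˡ : {φ ψ : SetFunction V} → (∀ S → φ S ≈ 0#) → ∀ S → (φ ⋆ ψ) S ≈ 0#
  ⋆-zeroˡ e []      = trans (*-congʳ (e [])) (zeroˡ _)
  ⋆-zeroˡ e (v ∷ S) = trans (+-cong (⋆-zeroˡ (λ S → e (v ∷ S)) S) (⋆-zeroˡ e S)) (+-identityˡ 0#)

  ⋆-zeroʳ : {φ ψ : SetFunction V} → (∀ S → ψ S ≈ 0#) → ∀ S → (φ ⋆ ψ) S ≈ 0#
  ⋆-zeroʳ e []      = trans (*-congˡ (e [])) (zeroʳ _)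
  ⋆-zeroʳ e (v ∷ S) = trans (+-cong (⋆-zeroʳ e S) (⋆-zeroʳ (λ S → e (v ∷ S)) S)) (+-identityˡ 0#)

  ⊙-⋆ : (k : Carrier) (φ ψ : SetFunction V) → (k ⊙ φ) ⋆ ψ ≋ k ⊙ (φ ⋆ ψ)
  ⊙-⋆ k φ ψ []      = *-assoc _ _ _
  ⊙-⋆ k φ ψ (v ∷ S) = trans (+-cong (⊙-⋆ k (∂ v φ) ψ S) (⊙-⋆ k φ (∂ v ψ) S)) (sym (distribˡ _ _ _))

  ⋆-⊙ : (k : Carrier) (φ ψ : SetFunction V) → φ ⋆ (k ⊙ ψ) ≋ k ⊙ (φ ⋆ ψ)
  ⋆-⊙ k φ ψ []      = x∙yz≈y∙xz _ _ _
  ⋆-⊙ k φ ψ (v ∷ S) = trans (+-cong (⋆-⊙ k (∂ v φ) ψ S) (⋆-⊙ k φ (∂ v ψ) S)) (sym (distribˡ _ _ _))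

  ⋆-assoc : (φ ψ χ : SetFunction V) → (φ ⋆ ψ) ⋆ χ ≋ φ ⋆ (ψ ⋆ χ)
  ⋆-assoc φ ψ χ []      = *-assoc _ _ _
  ⋆-assoc φ ψ χ (v ∷ S) = begin
    ((∂ v φ ⋆ ψ ⊕ φ ⋆ ∂ v ψ) ⋆ χ) S + (φ ⋆ ψ ⋆ ∂ v χ) S
      ≈⟨ +-congʳ (⋆-distribʳ χ (∂ v φ ⋆ ψ) (φ ⋆ ∂ v ψ) S) ⟩
    ((∂ v φ ⋆ ψ ⋆ χ) S + (φ ⋆ ∂ v ψ ⋆ χ) S) + (φ ⋆ ψ ⋆ ∂ v χ) S
      ≈⟨ +-cong (+-cong (⋆-assoc (∂ v φ) ψ χ S) (⋆-assoc φ (∂ v ψ) χ S)) (⋆-assoc φ ψ (∂ v χ) S) ⟩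
    ((∂ v φ ⋆ (ψ ⋆ χ)) S + (φ ⋆ (∂ v ψ ⋆ χ)) S) + (φ ⋆ (ψ ⋆ ∂ v χ)) S
      ≈⟨ +-assoc _ _ _ ⟩
    (∂ v φ ⋆ (ψ ⋆ χ)) S + ((φ ⋆ (∂ v ψ ⋆ χ)) S + (φ ⋆ (ψ ⋆ ∂ v χ)) S)
      ≈⟨ +-congˡ (⋆-distribˡ φ (∂ v ψ ⋆ χ) (ψ ⋆ ∂ v χ) S) ⟨
    (∂ v φ ⋆ (ψ ⋆ χ)) S + (φ ⋆ (∂ v ψ ⋆ χ ⊕ ψ ⋆ ∂ v χ)) S ∎

  ⋆-identityʳ : (φ : SetFunction V) → φ ⋆ size 0 ≋ φ
  ⋆-identityʳ φ []      = *-identityʳ _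
  ⋆-identityʳ φ (v ∷ S) =
    trans (+-cong (⋆-identityʳ (∂ v φ) S) (⋆-zeroʳ (λ _ → refl) S)) (+-identityʳ _)

  ⋆-identityˡ : (φ : SetFunction V) → size 0 ⋆ φ ≋ φ
  ⋆-identityˡ φ []      = *-identityˡ _
  ⋆-identityˡ φ (v ∷ S) =
    trans (+-cong (⋆-zeroˡ (λ _ → refl) S) (⋆-identityˡ (∂ v φ) S)) (+-identityˡ _)

  -- A set of a + 1 elements has a + 1 ways of splitting off one element. In the induction the head
  -- is either that element, which gives one copy, or lies in the other part.
  size-1-⋆ : ∀ a (S : List V) → (size 1 ⋆ size a) S ≈ suc a · size (suc a) S
  size-1-⋆ a [] = trans (zeroˡ _) (sym (·-zero (suc a)))
    where
    ·-zero : ∀ n → n · 0# ≈ 0#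
    ·-zero zero    = refl
    ·-zero (suc n) = trans (+-identityˡ _) (·-zero n)
  size-1-⋆ zero    (v ∷ S) = +-cong (⋆-identityˡ (size 0) S) (⋆-zeroʳ (λ _ → refl) S)
  size-1-⋆ (suc a) (v ∷ S) = +-cong (⋆-identityˡ (size (suc a)) S) (size-1-⋆ a S)

  ⋆< : ℕ → (ℕ → SetFunction V) → SetFunction V
  ⋆< = big _⋆_ (size 0)

  ⋆<-cong : {φ ψ : ℕ → SetFunction V} (N : ℕ) → (∀ i → φ i ≋ ψ i) → ⋆< N φ ≋ ⋆< N ψ
  ⋆<-cong zero    e S = refl
  ⋆<-cong (suc N) e = ⋆-cong (e 0) (⋆<-cong N (e ∘ suc))

  ⋆-∑< : (φ : SetFunction V) (N : ℕ) (ψ : ℕ → SetFunction V) →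
    φ ⋆ (λ S → ∑< N (λ i → ψ i S)) ≋ λ S → ∑< N (λ i → (φ ⋆ ψ i) S)
  ⋆-∑< φ zero    ψ = ⋆-zeroʳ λ _ → refl
  ⋆-∑< φ (suc N) ψ S = trans (⋆-distribˡ φ (ψ 0) _ S) (+-congˡ (⋆-∑< φ N (ψ ∘ suc) S))

  ∂-at : ℕ → V → (ℕ → SetFunction V) → ℕ → SetFunction V
  ∂-at c v φ i = if does (c ℕ.≟ i) then ∂ v (φ i) else φ i

  -- Iterated Leibniz rule: exactly one factor receives `v`. Shifting `c` and the family together
  -- leaves `∂-at` unchanged by computation, so only the distribution of `φ 0` over the sum has to
  -- be proved.
  ∂-⋆< : (v : V) (N : ℕ) (φ : ℕ → SetFunction V) →
    ∂ v (⋆< N φ) ≋ λ S → ∑< N (λ c → ⋆< N (∂-at c v φ) S)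
  ∂-⋆< v zero    φ S = refl
  ∂-⋆< v (suc N) φ S = +-congˡ (begin
    (φ 0 ⋆ ∂ v (⋆< N (φ ∘ suc))) S
      ≈⟨ ⋆-cong (λ _ → refl) (∂-⋆< v N (φ ∘ suc)) S ⟩
    (φ 0 ⋆ (λ S → ∑< N (λ c → ⋆< N (∂-at c v (φ ∘ suc)) S))) S
      ≈⟨ ⋆-∑< (φ 0) N (λ c → ⋆< N (∂-at c v (φ ∘ suc))) S ⟩
    ∑< N (λ c → (φ 0 ⋆ ⋆< N (∂-at c v (φ ∘ suc))) S) ∎)

  ⋆<-[] : ∀ N (φ : ℕ → SetFunction V) → ⋆< N φ [] ≈ ∏< N (λ i → φ i [])
  ⋆<-[] zero    φ = refl
  ⋆<-[] (suc N) φ = *-congˡ (⋆<-[] N (φ ∘ suc))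

  -- A colouring with colours below `N` is an ordered partition into `N` classes. Giving the first
  -- vertex colour `c` lets factor `c` absorb it, which replaces `φ` by `∂-at c v φ`; hence `vs` and
  -- `φ` are both arbitrary in the induction.
  ∑-colourings : ∀ N {n} (vs : Fin n → V) (φ : ℕ → SetFunction V) →
    ∑ (colouringsBelow N n) (λ f → ∏< N (λ i → φ i (colourClass vs f i))) ≈ ⋆< N φ (tabulate vs)
  ∑-colourings N {zero}  vs φ = trans (+-identityʳ _) (sym (⋆<-[] N φ))
  ∑-colourings N {suc n} vs φ = begin
    ∑ (colouringsBelow N (suc n)) (λ f → ∏< N (λ i → φ i (colourClass vs f i)))
      ≈⟨ ∑-cartesianProductWith (λ f → ∏< N (λ i → φ i (colourClass vs f i)))
           Vector._∷_ (applyUpTo id N) (colouringsBelow N n) ⟩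
    ∑ (applyUpTo id N) (λ c → ∑ (colouringsBelow N n) (λ f → ∏< N (λ i →
      φ i (if does (c ℕ.≟ i) then v ∷ colourClass vs′ f i else colourClass vs′ f i))))
      ≡⟨ ∑-applyUpTo _ id N ⟩
    ∑< N (λ c → ∑ (colouringsBelow N n) (λ f → ∏< N (λ i →
      φ i (if does (c ℕ.≟ i) then v ∷ colourClass vs′ f i else colourClass vs′ f i))))
      ≈⟨ ∑<-cong N (λ c → ∑-cong (colouringsBelow N n) λ f → ∏<-cong N λ i → step c i (colourClass vs′ f i)) ⟩
    ∑< N (λ c → ∑ (colouringsBelow N n) (λ f → ∏< N (λ i → ∂-at c v φ i (colourClass vs′ f i))))
      ≈⟨ ∑<-cong N (λ c → ∑-colourings N vs′ (∂-at c v φ)) ⟩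
    ∑< N (λ c → ⋆< N (∂-at c v φ) (tabulate vs′))
      ≈⟨ ∂-⋆< v N φ (tabulate vs′) ⟨
    ⋆< N φ (v ∷ tabulate vs′) ∎
    where
    v   = vs Fin.zero
    vs′ = vs ∘ Fin.suc
    step : ∀ c i S → φ i (if does (c ℕ.≟ i) then v ∷ S else S) ≈ ∂-at c v φ i S
    step c i S with does (c ℕ.≟ i)
    ... | true  = refl
    ... | false = refl

-- Edges inside colour classes

indicator : Bool → ℕ
indicator b = if b then 1 else 0

module ℕSums = Sums ℕ.+-*-commutativeSemiring

degree : Graph n → Fin n → List (Fin n) → ℕ
degree G v S = ℕSums.∑ S (λ u → indicator (adjacent G v u))

-- An edge is charged to the endpoint that comes first in the list, not to the smaller one, so that
-- removing the head leaves a degree and a smaller count.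
edgeCount : Graph n → List (Fin n) → ℕ
edgeCount G []      = 0
edgeCount G (v ∷ S) = degree G v S ℕ.+ edgeCount G S

module _ where
  open ℕSums
  open ≡.≡-Reasoning

  length-filter : {P : X → Set p} (P? : Decidable P) (xs : List X) →
    length (filter P? xs) ≡ ∑ xs (λ x → indicator (does (P? x)))
  length-filter P? []       = ≡.refl
  length-filter P? (x ∷ xs) with does (P? x)
  ... | true  = ≡.cong suc (length-filter P? xs)
  ... | false = length-filter P? xs

  ∑-colourClass : (vs : Fin n → V) (f : V → ℕ) (i : ℕ) (φ : V → ℕ) →
    ∑ (colourClass vs (f ∘ vs) i) φ ≡ ∑ (tabulate vs) (λ u → if does (f u ℕ.≟ i) then φ u else 0)
  ∑-colourClass {n = zero}  vs f i φ = ≡.refl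
  ∑-colourClass {n = suc n} vs f i φ with does (f (vs Fin.zero) ℕ.≟ i)
  ... | true  = ≡.cong (φ (vs Fin.zero) ℕ.+_) (∑-colourClass (vs ∘ Fin.suc) f i φ)
  ... | false = ∑-colourClass (vs ∘ Fin.suc) f i φ

  ordered-edge : Graph n → Fin n → Fin n → ℕ
  ordered-edge G u v = indicator (does (u Fin.<? v) ∧ adjacent G u v)

  -- Adding `x` adds a row and a column to the double sum. Their entries at `v` add up to the
  -- adjacency of `x` and `v`, as at most one of the two orders is increasing, and the corner
  -- vanishes because there are no loops.
  edgeCount-ordered : (G : Graph n) (S : List (Fin n)) →
    edgeCount G S ≡ ∑ S (λ u → ∑ S (ordered-edge G u))
  edgeCount-ordered G []      = ≡.refl
  edgeCount-ordered G (x ∷ S) = begin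
    degree G x S ℕ.+ edgeCount G S
      ≡⟨ ≡.cong₂ ℕ._+_ (∑-cong S either-order) (edgeCount-ordered G S) ⟩
    ∑ S (λ v → o x v ℕ.+ o v x) ℕ.+ ∑ S (λ u → ∑ S (o u))
      ≡⟨ ≡.cong (ℕ._+ ∑ S (λ u → ∑ S (o u))) (∑-+ (o x) (λ v → o v x) S) ⟩
    (∑ S (o x) ℕ.+ ∑ S (λ v → o v x)) ℕ.+ ∑ S (λ u → ∑ S (o u))
      ≡⟨ ℕ.+-assoc (∑ S (o x)) _ _ ⟩
    ∑ S (o x) ℕ.+ (∑ S (λ v → o v x) ℕ.+ ∑ S (λ u → ∑ S (o u)))
      ≡⟨ ≡.cong₂ ℕ._+_ (≡.cong (ℕ._+ ∑ S (o x)) (≡.sym loopless)) (≡.sym (∑-+ (λ u → o u x) (λ u → ∑ S (o u)) S)) ⟩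
    (o x x ℕ.+ ∑ S (o x)) ℕ.+ ∑ S (λ u → o u x ℕ.+ ∑ S (o u)) ∎
    where
    o = ordered-edge G
    no-loop : ∀ v → adjacent G v v ≡ false
    no-loop v = ¬-not (irreflexive G v ∘ Equivalence.from T-≡)
    loopless : o x x ≡ 0
    loopless rewrite no-loop x = ≡.cong indicator (∧-zeroʳ (does (x Fin.<? x)))
    adjacent-sym : ∀ u v → adjacent G u v ≡ adjacent G v u
    adjacent-sym u v = does-⇔ (mk⇔ (symmetric G u v) (symmetric G v u)) (T? _) (T? _)
    either-order : ∀ v → indicator (adjacent G x v) ≡ o x v ℕ.+ o v x
    either-order v with Fin.<-cmp x v
    ... | tri< x<v _ v≮x rewrite dec-true (x Fin.<? v) x<v | dec-false (v Fin.<? x) v≮x = ≡.sym (ℕ.+-identityʳ _)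
    ... | tri≈ x≮v ≡.refl _ rewrite loopless | no-loop x = ≡.refl
    ... | tri> x≮v _ v<x rewrite dec-false (x Fin.<? v) x≮v | dec-true (v Fin.<? x) v<x =
      ≡.cong indicator (adjacent-sym x v)

  -- Both counts are brought to one double sum over all pairs of vertices: the left one by turning
  -- membership in the class into an `if`, the right one by unfolding the two filters.
  edgeCount-colourClass : (G : Graph n) (f : Colouring n) (i : ℕ) →
    edgeCount G (colourClass id f i) ≡ monochromatic G f i
  edgeCount-colourClass {n = n} G f i = begin
    edgeCount G C
      ≡⟨ edgeCount-ordered G C ⟩
    ∑ C (λ u → ∑ C (ordered-edge G u))
      ≡⟨ ∑-cong C (λ u → ∑-colourClass id f i (ordered-edge G u)) ⟩
    ∑ C (λ u → ∑ (allFin n) (λ v → if does (f v ℕ.≟ i) then ordered-edge G u v else 0))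
      ≡⟨ ∑-colourClass id f i _ ⟩
    ∑ (allFin n) (λ u → if does (f u ℕ.≟ i)
      then ∑ (allFin n) (λ v → if does (f v ℕ.≟ i) then ordered-edge G u v else 0) else 0)
      ≡⟨ ∑-cong (allFin n) (λ u → row u (does (f u ℕ.≟ i))) ⟩
    ∑ (allFin n) (λ u → ∑ (allFin n) (λ v → count (u , v)))
      ≡⟨ ∑-cartesianProductWith count _,_ (allFin n) (allFin n) ⟨
    ∑ (cartesianProductWith _,_ (allFin n) (allFin n)) count
      ≡⟨ ∑-filter _ _ (cartesianProductWith _,_ (allFin n) (allFin n)) ⟨
    ∑ (edges G) (λ (u , v) → indicator (does (f u ℕ.≟ i) ∧ does (f v ℕ.≟ i)))
      ≡⟨ length-filter (λ (u , v) → (f u ℕ.≟ i) ×-dec (f v ℕ.≟ i)) (edges G) ⟨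
    monochromatic G f i ∎
    where
    C = colourClass id f i
    count : Fin n × Fin n → ℕ
    count (u , v) = if does (u Fin.<? v) ∧ adjacent G u v
                    then indicator (does (f u ℕ.≟ i) ∧ does (f v ℕ.≟ i)) else 0
    interchange : ∀ e a b → (if a then (if b then indicator e else 0) else 0) ≡ (if e then indicator (a ∧ b) else 0)
    interchange false false _     = ≡.refl
    interchange false true  false = ≡.refl
    interchange false true  true  = ≡.refl
    interchange true  false _     = ≡.refl
    interchange true  true  false = ≡.refl
    interchange true  true  true  = ≡.refl
    if-zero : ∀ e → (if e then 0 else 0) ≡ 0
    if-zero false = ≡.refl
    if-zero true  = ≡.refl
    row : ∀ u a → (if a then ∑ (allFin n) (λ v → if does (f v ℕ.≟ i) then ordered-edge G u v else 0) else 0)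
      ≡ ∑ (allFin n) (λ v → if does (u Fin.<? v) ∧ adjacent G u v
          then indicator (a ∧ does (f v ℕ.≟ i)) else 0)
    row u false = ≡.sym (∑-zero (allFin n) λ v → if-zero (does (u Fin.<? v) ∧ adjacent G u v))
    row u true  = ∑-cong (allFin n) λ v → interchange (does (u Fin.<? v) ∧ adjacent G u v) true (does (f v ℕ.≟ i))

-- Class sizes, bounds on colours and proper colourings.

length-colourClass : (vs : Fin n → V) (f : Colouring n) (i : ℕ) →
  length (colourClass vs f i) ≡ exponent (xᶠ f) i
length-colourClass {n = zero}  vs f i = ≡.refl
length-colourClass {n = suc n} vs f i with does (f Fin.zero ℕ.≟ i)
... | true  = ≡.cong suc (length-colourClass (vs ∘ Fin.suc) (f ∘ Fin.suc) i)
... | false = length-colourClass (vs ∘ Fin.suc) (f ∘ Fin.suc) i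

colourClass-unused : (vs : Fin n → V) (f : Colouring n) (i : ℕ) →
  (∀ v → f v ≢ i) → colourClass vs f i ≡ []
colourClass-unused {n = zero}  vs f i f≢i = ≡.refl
colourClass-unused {n = suc n} vs f i f≢i
  rewrite dec-false (f Fin.zero ℕ.≟ i) (f≢i Fin.zero) =
  colourClass-unused (vs ∘ Fin.suc) (f ∘ Fin.suc) i (f≢i ∘ Fin.suc)

colouringsBelow-< : ∀ N n → All (λ f → ∀ v → f v < N) (colouringsBelow N n)
colouringsBelow-< N zero    = (λ ()) ∷ []
colouringsBelow-< N (suc n) = All.cartesianProductWith⁺ (≡.setoid _) (≡.setoid _) Vector._∷_ _ _
  λ c∈ f∈ → λ { Fin.zero → ∈-upTo⁻ c∈ ; (Fin.suc v) → All.lookup (colouringsBelow-< N n) f∈ v }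

-- The right-hand side is `qᶠ G f ≈ᴹᵒ ε` unfolded. This is what identifies Ψ with the value of Ψ̃ at
-- q = 0.
proper-⇔ : (G : Graph n) (f : Colouring n) → Proper G f ⇔ (∀ i → monochromatic G f i ≡ 0)
proper-⇔ G f = mk⇔ to from
  where
  to : Proper G f → ∀ i → monochromatic G f i ≡ 0
  to proper i = ≡.cong length (filter-none monochromatic? (All.tabulate {xs = edges G}
    λ {(u , v)} uv∈ (fu≡i , fv≡i) → proper u v (edge uv∈) (≡.trans fu≡i (≡.sym fv≡i))))
    where
    monochromatic? : Decidable (λ (u , v) → f u ≡ i × f v ≡ i)
    monochromatic? (u , v) = (f u ℕ.≟ i) ×-dec (f v ℕ.≟ i)
    edge : ∀ {u v} → (u , v) ∈ edges G → T (adjacent G u v)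
    edge uv∈ = proj₂ (proj₂ (∈-filter⁻ (λ (u , v) → (u Fin.<? v) ×-dec T? (adjacent G u v))
      {xs = cartesianProductWith _,_ (allFin _) (allFin _)} uv∈))
  nonempty : {xs : List X} {x : X} → x ∈ xs → length xs ≢ 0
  nonempty {xs = _ ∷ _} _ ()
  -- `edges` holds increasing pairs only; a decreasing pair is reduced to this case by the symmetry
  -- of adjacency.
  increasing : (∀ i → monochromatic G f i ≡ 0) → ∀ u v → u Fin.< v → T (adjacent G u v) → f u ≢ f v
  increasing none u v u<v uv fu≡fv = nonempty
    (∈-filter⁺ _ (∈-filter⁺ _ (∈-cartesianProductWith⁺ _,_ (∈-allFin u) (∈-allFin v)) (u<v , uv)) (fu≡fv , ≡.refl))
    (none (f v))
  from : (∀ i → monochromatic G f i ≡ 0) → Proper G f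
  from none u v uv with Fin.<-cmp u v
  ... | tri< u<v _ _      = increasing none u v u<v uv
  ... | tri≈ _ ≡.refl _   = contradiction uv (irreflexive G u)
  ... | tri> _ _ v<u      = ≢-sym (increasing none v u v<u (symmetric G u v uv))

-- Homomorphisms and convolution.

-- Two maps will be of this kind: the embedding of constants and the evaluation at q = 0. Sums and
-- convolutions involve no subtraction, so semirings suffice.
IsHomomorphism : (A : CommutativeSemiring a b) (B : CommutativeSemiring c ℓ) →
  (CommutativeSemiring.Carrier A → CommutativeSemiring.Carrier B) → Set _
IsHomomorphism A B = IsSemiringHomomorphism
  where open SemiringMorphisms (CommutativeSemiring.rawSemiring A) (CommutativeSemiring.rawSemiring B)

module Homomorphism (A : CommutativeSemiring a b) (B : CommutativeSemiring c ℓ)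
  (h : CommutativeSemiring.Carrier A → CommutativeSemiring.Carrier B) (isHom : IsHomomorphism A B h) where
  private
    module A = CommutativeSemiring A
    module A↑ = Exponentiation A.semiring
    module A· = Multiplication A.semiring
    module A⋆ = Convolution A
    module A∑ = Sums A
  open CommutativeSemiring B
  open SemiringMorphisms.IsSemiringHomomorphism isHom
  open Exponentiation semiring
  open Multiplication semiring using () renaming (_×_ to _·_)
  open Convolution B
  open Sums B

  homo-∑ : (φ : X → A.Carrier) (xs : List X) → h (A∑.∑ xs φ) ≈ ∑ xs (h ∘ φ)
  homo-∑ φ []       = 0#-homo
  homo-∑ φ (x ∷ xs) = trans (+-homo _ _) (+-congˡ (homo-∑ φ xs))

  homo-^ : ∀ x n → h (x A↑.^ n) ≈ h x ^ n
  homo-^ x zero    = 1#-homo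
  homo-^ x (suc n) = trans (*-homo _ _) (*-congˡ (homo-^ x n))

  homo-· : ∀ n x → h (n A·.× x) ≈ n · h x
  homo-· zero    x = 0#-homo
  homo-· (suc n) x = trans (+-homo _ _) (+-congˡ (homo-· n x))

  homo-size : ∀ a (S : List V) → h (A⋆.size a S) ≈ size a S
  homo-size zero    []      = 1#-homo
  homo-size zero    (_ ∷ _) = 0#-homo
  homo-size (suc a) []      = 0#-homo
  homo-size (suc a) (_ ∷ S) = homo-size a S

  homo-⋆ : (φ ψ : A⋆.SetFunction V) → h ∘ (φ A⋆.⋆ ψ) ≋ (h ∘ φ) ⋆ (h ∘ ψ)
  homo-⋆ φ ψ []      = *-homo _ _
  homo-⋆ φ ψ (v ∷ S) = trans (+-homo _ _) (+-cong (homo-⋆ (A⋆.∂ v φ) ψ S) (homo-⋆ φ (A⋆.∂ v ψ) S))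

  homo-⋆< : ∀ N (φ : ℕ → A⋆.SetFunction V) → h ∘ A⋆.⋆< N φ ≋ ⋆< N (λ i → h ∘ φ i)
  homo-⋆< zero    φ S = homo-size 0 S
  homo-⋆< (suc N) φ S =
    trans (homo-⋆ (φ 0) (A⋆.⋆< N (φ ∘ suc)) S) (⋆-cong (λ _ → refl) (homo-⋆< N (φ ∘ suc)) S)

-- Sizes, stable sets and edge counts as set functions of a graph.

module Weights (A : CommutativeSemiring c ℓ) where
  open CommutativeSemiring A hiding (zero)
  open import Relation.Binary.Reasoning.Setoid setoid
  open Exponentiation semiring
  open Multiplication semiring using () renaming (_×_ to _·_; ×-homo-+ to ·-homo-+)
  open Convolution A
  open Sums A

  Family : Set c
  Family = (γ : ∃ Graph) → SetFunction (Fin (proj₁ γ))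

  -- Linear in `Φ` for scalars that do not depend on the graph, so identities between set functions
  -- turn into identities between coefficients summed over `z`.
  eval : List (Carrier × ∃ Graph) → Family → Carrier
  eval z Φ = ∑ z (λ (k , γ) → k * Φ γ (allFin (proj₁ γ)))

  -- At r = 0# this is the indicator function of the stable sets with a elements.
  weight : Carrier → ℕ → Family
  weight r a (_ , G) S = size a S * r ^ edgeCount G S

  sizedEdges : ℕ → Family
  sizedEdges a (_ , G) S = size a S * (edgeCount G S · 1#)

  eval-cong : ∀ z {Φ Ψ : Family} → (∀ γ → Φ γ ≋ Ψ γ) → eval z Φ ≈ eval z Ψ
  eval-cong z e = ∑-cong z λ (k , γ) → *-congˡ (e γ _)

  eval-⊕ : ∀ z (Φ Ψ : Family) → eval z (λ γ → Φ γ ⊕ Ψ γ) ≈ eval z Φ + eval z Ψ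
  eval-⊕ z Φ Ψ = trans (∑-cong z λ _ → distribˡ _ _ _) (∑-+ _ _ z)

  eval-⊙ : ∀ z k (Φ : Family) → eval z (λ γ → k ⊙ Φ γ) ≈ k * eval z Φ
  eval-⊙ z k Φ = trans (∑-cong z λ _ → x∙yz≈y∙xz _ _ _) (∑-*ˡ k _ z)
    where open CommutativeSemigroupProperties *-commutativeSemigroup

  -- A single vertex is always stable. Hence `size 1` is controlled by Ψ from the start, and the
  -- larger sizes are built from it.
  weight-0-1 : ∀ γ → weight 0# 1 γ ≋ size 1
  weight-0-1 γ []          = zeroˡ _
  weight-0-1 γ (_ ∷ [])    = *-identityˡ _
  weight-0-1 γ (_ ∷ _ ∷ _) = zeroˡ _

  sizedEdges-0 : ∀ γ S → sizedEdges 0 γ S ≈ 0#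
  sizedEdges-0 γ []      = zeroʳ _
  sizedEdges-0 γ (_ ∷ _) = zeroˡ _

  sizedEdges-1 : ∀ γ S → sizedEdges 1 γ S ≈ 0#
  sizedEdges-1 γ []          = zeroˡ _
  sizedEdges-1 γ (_ ∷ [])    = zeroʳ _
  sizedEdges-1 γ (_ ∷ _ ∷ _) = zeroˡ _

  -- A pair of vertices is either stable or spans exactly one edge.
  weight-0-2 : ∀ γ → size 2 ≋ weight 0# 2 γ ⊕ sizedEdges 2 γ
  weight-0-2 γ []              = sym (trans (+-cong (zeroˡ _) (zeroˡ _)) (+-identityˡ _))
  weight-0-2 γ (_ ∷ [])        = sym (trans (+-cong (zeroˡ _) (zeroˡ _)) (+-identityˡ _))
  weight-0-2 γ (_ ∷ _ ∷ _ ∷ _) = sym (trans (+-cong (zeroˡ _) (zeroˡ _)) (+-identityˡ _))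
  weight-0-2 (_ , G) (u ∷ v ∷ []) with adjacent G u v
  ... | true  = sym (begin
    1# * (0# * 1#) + 1# * (1# + 0#) ≈⟨ +-cong (*-congˡ (zeroˡ _)) (*-identityˡ _) ⟩
    1# * 0# + (1# + 0#)             ≈⟨ +-cong (zeroʳ _) (+-identityʳ _) ⟩
    0# + 1#                         ≈⟨ +-identityˡ _ ⟩
    1#                              ∎)
  ... | false = sym (trans (+-cong (*-identityˡ _) (zeroʳ _)) (+-identityʳ _))

  -- The extra term that `∂ v` produces from `sizedEdges`: the edges from `v` into the rest.
  sizedDegree : ℕ → Graph n → Fin n → SetFunction (Fin n)
  sizedDegree a G v S = size a S * (degree G v S · 1#)

  sizedDegree-0 : (G : Graph n) (v : Fin n) → ∀ S → sizedDegree 0 G v S ≈ 0#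
  sizedDegree-0 G v []      = zeroʳ _
  sizedDegree-0 G v (_ ∷ _) = zeroˡ _

  size-*-split : ∀ a (S : List V) m k → size a S * ((m ℕ.+ k) · 1#) ≈ size a S * (m · 1#) + size a S * (k · 1#)
  size-*-split a S m k = trans (*-congˡ (·-homo-+ 1# m k)) (distribˡ _ _ _)

  -- In a set of a + 1 elements, each neighbour of `v` is the singleton part of exactly one
  -- partition. The head `u` contributes its own adjacency as that singleton; otherwise it belongs
  -- to the other part.
  sizedDegree-⋆ : (G : Graph n) (v : Fin n) (a : ℕ) →
    sizedDegree 1 G v ⋆ size a ≋ sizedDegree (suc a) G v
  sizedDegree-⋆ G v a []      = trans (*-congʳ (zeroˡ _)) (trans (zeroˡ _) (sym (zeroˡ _)))
  sizedDegree-⋆ G v a (u ∷ S) = begin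
    (∂ u (sizedDegree 1 G v) ⋆ size a) S + (sizedDegree 1 G v ⋆ ∂ u (size a)) S
      ≈⟨ +-cong (⋆-cong first (λ _ → refl) S) (second a) ⟩
    ((k · 1#) ⊙ size 0 ⋆ size a) S + sizedDegree a G v S
      ≈⟨ +-congʳ (trans (⊙-⋆ (k · 1#) (size 0) (size a) S) (*-congˡ (⋆-identityˡ (size a) S))) ⟩
    (k · 1#) * size a S + sizedDegree a G v S
      ≈⟨ +-congʳ (*-comm _ _) ⟩
    size a S * (k · 1#) + sizedDegree a G v S
      ≈⟨ size-*-split a S k (degree G v S) ⟨
    sizedDegree (suc a) G v (u ∷ S) ∎
    where
    k = indicator (adjacent G v u)
    first : ∂ u (sizedDegree 1 G v) ≋ (k · 1#) ⊙ size 0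
    first S = begin
      size 0 S * ((k ℕ.+ degree G v S) · 1#)      ≈⟨ size-*-split 0 S k (degree G v S) ⟩
      size 0 S * (k · 1#) + sizedDegree 0 G v S   ≈⟨ +-cong (*-comm _ _) (sizedDegree-0 G v S) ⟩
      (k · 1#) * size 0 S + 0#                    ≈⟨ +-identityʳ _ ⟩
      (k · 1#) * size 0 S                         ∎
    second : ∀ a → (sizedDegree 1 G v ⋆ ∂ u (size a)) S ≈ sizedDegree a G v S
    second zero    = trans (⋆-zeroʳ (λ _ → refl) S) (sym (sizedDegree-0 G v S))
    second (suc a) = sizedDegree-⋆ G v a S

  -- Every edge of S is counted once, as the part of size two.
  sizedEdges-⋆ : ∀ γ a → sizedEdges 2 γ ⋆ size a ≋ sizedEdges (2 ℕ.+ a) γ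
  sizedEdges-⋆ γ a []      = trans (*-congʳ (zeroˡ _)) (trans (zeroˡ _) (sym (zeroˡ _)))
  sizedEdges-⋆ γ@(_ , G) a (v ∷ S) = begin
    (∂ v (sizedEdges 2 γ) ⋆ size a) S + (sizedEdges 2 γ ⋆ ∂ v (size a)) S
      ≈⟨ +-cong (⋆-cong first (λ _ → refl) S) (second a) ⟩
    (sizedDegree 1 G v ⋆ size a) S + sizedEdges (suc a) γ S
      ≈⟨ +-congʳ (sizedDegree-⋆ G v a S) ⟩
    sizedDegree (suc a) G v S + sizedEdges (suc a) γ S
      ≈⟨ size-*-split (suc a) S (degree G v S) (edgeCount G S) ⟨
    sizedEdges (2 ℕ.+ a) γ (v ∷ S) ∎
    where
    first : ∂ v (sizedEdges 2 γ) ≋ sizedDegree 1 G v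
    first S = trans (size-*-split 1 S (degree G v S) (edgeCount G S))
      (trans (+-congˡ (sizedEdges-1 γ S)) (+-identityʳ _))
    second : ∀ a → (sizedEdges 2 γ ⋆ ∂ v (size a)) S ≈ sizedEdges (suc a) γ S
    second zero    = trans (⋆-zeroʳ (λ _ → refl) S) (sym (sizedEdges-1 γ S))
    second (suc a) = sizedEdges-⋆ γ a S

-- `Good` ranges over arbitrary sequences of exponents, Ψ over monomials. The recursion follows that
-- of `⋆<`, so shifting the truncation of `a` gives that of `a ∘ suc`.
truncate : ℕ → (ℕ → ℕ) → Monomial
truncate N a = record { exponent = e N a ; bound = N ; vanishes = e-vanishes N a }
  where
  e : ℕ → (ℕ → ℕ) → ℕ → ℕ
  e zero    a i       = 0
  e (suc N) a zero    = a 0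
  e (suc N) a (suc i) = e N (a ∘ suc) i
  e-vanishes : ∀ N a i → N ≤ i → e N a i ≡ 0
  e-vanishes zero    a i       N≤i         = ≡.refl
  e-vanishes (suc N) a (suc i) (ℕ.s≤s N≤i) = e-vanishes N (a ∘ suc) i N≤i

-- From stable sets to sizes, edge counts and powers of q.

module Reduction
  (K : CommutativeSemiring a b) (R : CommutativeRing c ℓ)
  (ι : CommutativeSemiring.Carrier K → CommutativeRing.Carrier R)
  (ι-isHom : IsHomomorphism K (CommutativeRing.commutativeSemiring R) ι)
  where

  module _ where
    open CommutativeSemiring K hiding (zero)
    open import Relation.Binary.Reasoning.Setoid setoid
    open Multiplication semiring using () renaming (_×_ to _·_; ×-assoc-* to ·-assoc-*)
    open Convolution K
    open Weights K

    module _ (torsionFree : ∀ n x → (suc n · 1#) * x ≈ 0# → x ≈ 0#) (z : List (Carrier × ∃ Graph)) where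

      -- Quantifying over all products of stable factors lets one of them pass into `Φ`, and makes
      -- every replacement in `Φ` valid in the presence of the others.
      Good : Family → Set b
      Good Φ = ∀ N (a : ℕ → ℕ) → eval z (λ γ → Φ γ ⋆ ⋆< N (λ i → weight 0# (a i) γ)) ≈ 0#

      good-cong : {Φ Ψ : Family} → (∀ γ → Φ γ ≋ Ψ γ) → Good Φ → Good Ψ
      good-cong e good N a = trans (eval-cong z λ γ → ⋆-cong (λ S → sym (e γ S)) (λ _ → refl)) (good N a)

      good-unit : (∀ x → eval z (λ γ → ⋆< (bound x) (λ i → weight 0# (exponent x i) γ)) ≈ 0#) →
        Good (λ _ → size 0)
      good-unit vanishing N a = trans
        (eval-cong z λ γ S → trans (⋆-identityˡ (⋆< N (λ i → weight 0# (a i) γ)) S)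
          (reflexive (≡.cong (λ φ → φ S) (truncated γ N a))))
        (vanishing (truncate N a))
        where
        truncated : ∀ γ N a → ⋆< N (λ i → weight 0# (a i) γ) ≡ ⋆< N (λ i → weight 0# (exponent (truncate N a) i) γ)
        truncated γ zero    a = ≡.refl
        truncated γ (suc N) a = ≡.cong (weight 0# (a 0) γ ⋆_) (truncated γ N (a ∘ suc))

      -- Associativity moves the new factor into the product, where `b` becomes the first exponent
      -- in front of `a`.
      good-weight : (Φ : Family) → Good Φ → ∀ b → Good (λ γ → Φ γ ⋆ weight 0# b γ)
      good-weight Φ good b N a = trans
        (eval-cong z λ γ → ⋆-assoc (Φ γ) (weight 0# b γ) _)
        (good (suc N) λ { zero → b ; (suc i) → a i })

      -- The singleton factor produced in each step is absorbed into the prefix, so the induction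
      -- ranges over all `Φ`. The multiplier `suc b` is then cancelled by `torsionFree`.
      good-size : ∀ b (Φ : Family) → Good Φ → Good (λ γ → Φ γ ⋆ size b)
      good-size zero    Φ good     = good-cong (λ γ S → sym (⋆-identityʳ (Φ γ) S)) good
      good-size (suc b) Φ good N a = torsionFree b _ (begin
        (suc b · 1#) * eval z (λ γ → Φ γ ⋆ size (suc b) ⋆ rest γ)
          ≈⟨ eval-⊙ z (suc b · 1#) (λ γ → Φ γ ⋆ size (suc b) ⋆ rest γ) ⟨
        eval z (λ γ → (suc b · 1#) ⊙ (Φ γ ⋆ size (suc b) ⋆ rest γ))
          ≈⟨ eval-cong z (λ γ S → ⊙-⋆ (suc b · 1#) (Φ γ ⋆ size (suc b)) (rest γ) S) ⟨
        eval z (λ γ → ((suc b · 1#) ⊙ (Φ γ ⋆ size (suc b))) ⋆ rest γ)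
          ≈⟨ eval-cong z (λ γ → ⋆-cong (split γ) (λ _ → refl)) ⟩
        eval z (λ γ → Φ γ ⋆ weight 0# 1 γ ⋆ size b ⋆ rest γ)
          ≈⟨ good-size b _ (good-weight Φ good 1) N a ⟩
        0# ∎)
        where
        rest : Family
        rest γ = ⋆< N (λ i → weight 0# (a i) γ)
        split : ∀ γ → (suc b · 1#) ⊙ (Φ γ ⋆ size (suc b)) ≋ Φ γ ⋆ weight 0# 1 γ ⋆ size b
        split γ S = begin
          (suc b · 1#) * (Φ γ ⋆ size (suc b)) S
            ≈⟨ ⋆-⊙ (suc b · 1#) (Φ γ) (size (suc b)) S ⟨
          (Φ γ ⋆ (suc b · 1#) ⊙ size (suc b)) S
            ≈⟨ ⋆-cong (λ _ → refl) (λ S → trans (·-assoc-* (suc b) 1# _)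
                 (×-congʳ (suc b) (*-identityˡ _))) S ⟩
          (Φ γ ⋆ (λ S → suc b · size (suc b) S)) S
            ≈⟨ ⋆-cong (λ _ → refl) (size-1-⋆ b) S ⟨
          (Φ γ ⋆ (size 1 ⋆ size b)) S
            ≈⟨ ⋆-assoc (Φ γ) (size 1) (size b) S ⟨
          (Φ γ ⋆ size 1 ⋆ size b) S
            ≈⟨ ⋆-cong (⋆-cong (λ _ → refl) (weight-0-1 γ)) (λ _ → refl) S ⟨
          (Φ γ ⋆ weight 0# 1 γ ⋆ size b) S ∎
          where open Multiplication semiring using (×-congʳ)

      good-zero : (Φ : Family) → (∀ γ S → Φ γ S ≈ 0#) → Good Φ
      good-zero Φ e N a = trans
        -- Zero is written as 0 · 0 so that it can be taken out as a scalar.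
        (eval-cong z λ γ S → trans (⋆-zeroˡ {ψ = ⋆< N (λ i → weight 0# (a i) γ)} (e γ) S) (sym (zeroˡ 0#)))
        (trans (eval-⊙ z 0# (λ _ _ → 0#)) (zeroˡ _))

      -- The scalars are only a semiring here, so e₂ is not formed as s₂ - σ₂. The vanishing term
      -- with σ₂ is added to the term with e₂ instead, and together they give the vanishing term
      -- with s₂.
      good-sizedEdges-2 : (Φ : Family) → Good Φ → Good (λ γ → Φ γ ⋆ sizedEdges 2 γ)
      good-sizedEdges-2 Φ good N a = begin
        eval z E                ≈⟨ +-identityˡ _ ⟨
        0# + eval z E           ≈⟨ +-congʳ (good-weight Φ good 2 N a) ⟨
        eval z W + eval z E     ≈⟨ eval-⊕ z W E ⟨
        eval z (λ γ → W γ ⊕ E γ)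
          ≈⟨ eval-cong z (λ γ S → ⋆-distribʳ (rest γ) (Φ γ ⋆ weight 0# 2 γ) (Φ γ ⋆ sizedEdges 2 γ) S) ⟨
        eval z (λ γ → (Φ γ ⋆ weight 0# 2 γ ⊕ Φ γ ⋆ sizedEdges 2 γ) ⋆ rest γ)
          ≈⟨ eval-cong z (λ γ → ⋆-cong (λ S → trans (⋆-cong (λ _ → refl) (weight-0-2 γ) S)
               (⋆-distribˡ (Φ γ) (weight 0# 2 γ) (sizedEdges 2 γ) S)) (λ _ → refl)) ⟨
        eval z (λ γ → Φ γ ⋆ size 2 ⋆ rest γ) ≈⟨ good-size 2 Φ good N a ⟩
        0#                      ∎
        where
        rest W E : Family
        rest γ = ⋆< N (λ i → weight 0# (a i) γ)
        W γ = Φ γ ⋆ weight 0# 2 γ ⋆ rest γ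
        E γ = Φ γ ⋆ sizedEdges 2 γ ⋆ rest γ

      good-sizedEdges : ∀ b (Φ : Family) → Good Φ → Good (λ γ → Φ γ ⋆ sizedEdges b γ)
      good-sizedEdges 0 Φ good = good-zero _ λ γ → ⋆-zeroʳ (sizedEdges-0 γ)
      good-sizedEdges 1 Φ good = good-zero _ λ γ → ⋆-zeroʳ (sizedEdges-1 γ)
      good-sizedEdges (suc (suc b)) Φ good = good-cong
        (λ γ S → trans (⋆-assoc (Φ γ) (sizedEdges 2 γ) (size b) S) (⋆-cong (λ _ → refl) (sizedEdges-⋆ γ b) S))
        (good-size b _ (good-sizedEdges-2 Φ good))

  private
    module K = CommutativeSemiring K
    module K⋆ = Convolution K
    module KW = Weights K
    module K· = Multiplication K.semiring
  open CommutativeRing R hiding (zero)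
  open import Relation.Binary.Reasoning.Setoid setoid
  open SemiringMorphisms.IsSemiringHomomorphism ι-isHom
  open Homomorphism K commutativeSemiring ι ι-isHom
  open Exponentiation semiring
  open Multiplication semiring using () renaming (_×_ to _·_)
  open Convolution commutativeSemiring
  open Weights commutativeSemiring

  Relation : Carrier → Set ℓ
  Relation r = r * ((r - 1#) * (r - 1#)) ≈ 0#

  -- Modulo r (r - 1)², the function e ↦ r ^ e is a combination of 0 ^ e, 1 and e.
  module Expansion (r : Carrier) (relation : Relation r) where
    -- By the Chinese remainder theorem, modulo r (r - 1)² there are two components. On the one
    -- where r = 0, t² is 1 and `u` and `rt` vanish. On the other t² = 0, `u` is 1 and `rt` equals
    -- `t`, so r ^ e = (1 + t) ^ e = 1 + e t. These are the coefficients of 0 ^ e, 1 and e.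
    t u rt : Carrier
    t  = r - 1#
    u  = 1# - t * t
    rt = r * t

    t+1≈r : t + 1# ≈ r
    t+1≈r = begin
      (r - 1#) + 1#   ≈⟨ +-assoc _ _ _ ⟩
      r + (- 1# + 1#) ≈⟨ +-congˡ (-‿inverseˡ 1#) ⟩
      r + 0#          ≈⟨ +-identityʳ r ⟩
      r               ∎

    tt+u≈1 : t * t + u ≈ 1#
    tt+u≈1 = begin
      t * t + (1# - t * t)   ≈⟨ +-comm _ _ ⟩
      (1# - t * t) + t * t   ≈⟨ +-assoc _ _ _ ⟩
      1# + (- (t * t) + t * t) ≈⟨ +-congˡ (-‿inverseˡ _) ⟩
      1# + 0#                ≈⟨ +-identityʳ 1# ⟩
      1#                     ∎

    rx≈tx+x : ∀ x → r * x ≈ t * x + x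
    rx≈tx+x x = begin
      r * x            ≈⟨ *-congʳ t+1≈r ⟨
      (t + 1#) * x     ≈⟨ distribʳ x t 1# ⟩
      t * x + 1# * x   ≈⟨ +-congˡ (*-identityˡ x) ⟩
      t * x + x        ∎

    -- `r` is t + 1, and t · rt = r t² = 0.
    r*rt≈rt : r * rt ≈ rt
    r*rt≈rt = begin
      r * (r * t)        ≈⟨ rx≈tx+x (r * t) ⟩
      t * (r * t) + rt   ≈⟨ +-congʳ (x∙yz≈y∙xz t r t) ⟩
      r * (t * t) + rt   ≈⟨ +-congʳ relation ⟩
      0# + rt            ≈⟨ +-identityˡ rt ⟩
      rt                 ∎
      where open CommutativeSemigroupProperties *-commutativeSemigroup

    u+rt≈r : u + rt ≈ r
    u+rt≈r = begin
      u + r * t         ≈⟨ +-congˡ (rx≈tx+x t) ⟩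
      u + (t * t + t)   ≈⟨ +-assoc _ _ _ ⟨
      (u + t * t) + t   ≈⟨ +-congʳ (+-comm _ _) ⟩
      (t * t + u) + t   ≈⟨ +-congʳ tt+u≈1 ⟩
      1# + t            ≈⟨ +-comm _ _ ⟩
      t + 1#            ≈⟨ t+1≈r ⟩
      r                 ∎

    ru≈r : r * u ≈ r
    ru≈r = begin
      r * u                 ≈⟨ +-identityˡ _ ⟨
      0# + r * u            ≈⟨ +-congʳ relation ⟨
      r * (t * t) + r * u   ≈⟨ distribˡ r _ _ ⟨
      r * (t * t + u)       ≈⟨ *-congˡ tt+u≈1 ⟩
      r * 1#                ≈⟨ *-identityʳ r ⟩
      r                     ∎

    -- Multiplication by `r` sends `u` to r = u + rt and fixes `rt`, so each step raises the
    -- coefficient of `rt` by one.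
    power-suc : ∀ e → r ^ suc e ≈ u + rt * (suc e · 1#)
    power-suc zero = begin
      r * 1#                 ≈⟨ *-identityʳ r ⟩
      r                      ≈⟨ u+rt≈r ⟨
      u + rt                 ≈⟨ +-congˡ (*-identityʳ rt) ⟨
      u + rt * 1#            ≈⟨ +-congˡ (*-congˡ (+-identityʳ 1#)) ⟨
      u + rt * (1# + 0#)     ∎
    power-suc (suc e) = begin
      r * r ^ suc e                       ≈⟨ *-congˡ (power-suc e) ⟩
      r * (u + rt * (suc e · 1#))         ≈⟨ distribˡ _ _ _ ⟩
      r * u + r * (rt * (suc e · 1#))     ≈⟨ +-cong (trans ru≈r (sym u+rt≈r)) (sym (*-assoc _ _ _)) ⟩
      (u + rt) + r * rt * (suc e · 1#)    ≈⟨ +-congˡ (*-congʳ r*rt≈rt) ⟩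
      (u + rt) + rt * (suc e · 1#)        ≈⟨ +-assoc _ _ _ ⟩
      u + (rt + rt * (suc e · 1#))        ≈⟨ +-congˡ (+-congʳ (*-identityʳ rt)) ⟨
      u + (rt * 1# + rt * (suc e · 1#))   ≈⟨ +-congˡ (distribˡ _ _ _) ⟨
      u + rt * (suc (suc e) · 1#)         ∎

    -- The term with t² is felt only at e = 0, where 0 ^ 0 = 1 and t² completes `u` to 1.
    power : ∀ e → r ^ e ≈ (t * t) * 0# ^ e + (u + rt * (e · 1#))
    power zero = sym (begin
      (t * t) * 1# + (u + rt * 0#)  ≈⟨ +-cong (*-identityʳ _) (trans (+-congˡ (zeroʳ _)) (+-identityʳ u)) ⟩
      t * t + u                     ≈⟨ tt+u≈1 ⟩
      1#                            ∎)
    power (suc e) = begin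
      r ^ suc e                                       ≈⟨ power-suc e ⟩
      u + rt * (suc e · 1#)                           ≈⟨ +-identityˡ _ ⟨
      0# + (u + rt * (suc e · 1#))                    ≈⟨ +-congʳ (trans (*-congˡ (zeroˡ _)) (zeroʳ _)) ⟨
      (t * t) * 0# ^ suc e + (u + rt * (suc e · 1#))  ∎

    -- All dependence on the graph and the set sits in functions defined over `K`, where Ψ takes its
    -- values; the scalars from `R` can be taken out of `eval`.
    weight-expansion : ∀ b γ → weight r b γ ≋
      (t * t) ⊙ (ι ∘ KW.weight K.0# b γ) ⊕ (u ⊙ (ι ∘ K⋆.size b) ⊕ rt ⊙ (ι ∘ KW.sizedEdges b γ))
    weight-expansion b γ@(_ , G) S = begin
      s * r ^ e
        ≈⟨ *-congˡ (power e) ⟩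
      s * ((t * t) * 0# ^ e + (u + rt * (e · 1#)))
        ≈⟨ trans (distribˡ _ _ _) (+-congˡ (distribˡ _ _ _)) ⟩
      s * ((t * t) * 0# ^ e) + (s * u + s * (rt * (e · 1#)))
        ≈⟨ +-cong (x∙yz≈y∙xz _ _ _) (+-cong (*-comm _ _) (x∙yz≈y∙xz _ _ _)) ⟩
      (t * t) * (s * 0# ^ e) + (u * s + rt * (s * (e · 1#)))
        ≈⟨ +-cong (*-congˡ (trans (*-homo _ _) (*-cong (homo-size b S) (trans (homo-^ K.0# e) (^-congˡ e 0#-homo)))))
             (+-cong (*-congˡ (homo-size b S))
               (*-congˡ (trans (*-homo _ _) (*-cong (homo-size b S)
                 (trans (homo-· e K.1#) (×-congʳ e 1#-homo)))))) ⟨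
      (t * t) * ι (KW.weight K.0# b γ S) + (u * ι (K⋆.size b S) + rt * ι (KW.sizedEdges b γ S)) ∎
      where
      open CommutativeSemigroupProperties *-commutativeSemigroup
      open Multiplication semiring using (×-congʳ)
      s = size b S
      e = edgeCount G S

  module _ (torsionFree : ∀ n x → (suc n K·.× K.1#) K.* x K.≈ K.0# → x K.≈ K.0#)
    (z : List (K.Carrier × ∃ Graph)) where

    ιz : List (Carrier × ∃ Graph)
    ιz = map (λ (k , γ) → ι k , γ) z

    eval-ι : (Φ : KW.Family) → ι (KW.eval z Φ) ≈ eval ιz (λ γ → ι ∘ Φ γ)
    eval-ι Φ = begin
      ι (KW.eval z Φ)                                         ≈⟨ homo-∑ _ z ⟩
      ∑ z (λ (k , γ) → ι (k K.* Φ γ (allFin (proj₁ γ))))       ≈⟨ ∑-cong z (λ _ → *-homo _ _) ⟩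
      ∑ z (λ (k , γ) → ι k * ι (Φ γ (allFin (proj₁ γ))))       ≡⟨ ∑-map _ _ z ⟨
      eval ιz (λ γ → ι ∘ Φ γ)                                 ∎
      where open Sums commutativeSemiring

    -- The prefix `Φ` over `K` collects the factors already expanded, while the product over `R`
    -- holds the remaining colours. Each of the three terms of the expansion leaves a good prefix.
    vanishing : ∀ N (r : ℕ → Carrier) → (∀ i → Relation (r i)) → (a : ℕ → ℕ) →
      (Φ : KW.Family) → Good torsionFree z Φ →
      eval ιz (λ γ → (ι ∘ Φ γ) ⋆ ⋆< N (λ i → weight (r i) (a i) γ)) ≈ 0#
    vanishing zero r relation a Φ good = begin
      eval ιz (λ γ → (ι ∘ Φ γ) ⋆ size 0)            ≈⟨ eval-cong ιz (λ γ → ⋆-cong (λ _ → refl) (homo-size 0)) ⟨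
      eval ιz (λ γ → (ι ∘ Φ γ) ⋆ (ι ∘ K⋆.size 0))   ≈⟨ eval-cong ιz (λ γ → homo-⋆ (Φ γ) (K⋆.size 0)) ⟨
      eval ιz (λ γ → ι ∘ (Φ γ K⋆.⋆ K⋆.size 0))      ≈⟨ eval-ι (λ γ → Φ γ K⋆.⋆ K⋆.size 0) ⟨
      ι (KW.eval z (λ γ → Φ γ K⋆.⋆ K⋆.size 0))      ≈⟨ ⟦⟧-cong (good 0 a) ⟩
      ι K.0#                                        ≈⟨ 0#-homo ⟩
      0#                                            ∎
    vanishing (suc N) r relation a Φ good = begin
      eval ιz (λ γ → (ι ∘ Φ γ) ⋆ (weight (r 0) (a 0) γ ⋆ rest γ))
        ≈⟨ eval-cong ιz (λ γ S → trans (sym (⋆-assoc (ι ∘ Φ γ) (weight (r 0) (a 0) γ) (rest γ) S))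
             (⋆-cong (expand γ) (λ _ → refl) S)) ⟩
      eval ιz (λ γ → ((t * t) ⊙ Φ₁ γ ⊕ (u ⊙ Φ₂ γ ⊕ rt ⊙ Φ₃ γ)) ⋆ rest γ)
        ≈⟨ eval-cong ιz (λ γ S → trans (⋆-distribʳ (rest γ) _ _ S) (+-cong (⊙-⋆ (t * t) (Φ₁ γ) (rest γ) S)
             (trans (⋆-distribʳ (rest γ) _ _ S) (+-cong (⊙-⋆ u (Φ₂ γ) (rest γ) S) (⊙-⋆ rt (Φ₃ γ) (rest γ) S))))) ⟩
      eval ιz (λ γ → (t * t) ⊙ (Φ₁ γ ⋆ rest γ) ⊕ (u ⊙ (Φ₂ γ ⋆ rest γ) ⊕ rt ⊙ (Φ₃ γ ⋆ rest γ)))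
        ≈⟨ trans (eval-⊕ ιz (λ γ → (t * t) ⊙ (Φ₁ γ ⋆ rest γ)) (λ γ → u ⊙ (Φ₂ γ ⋆ rest γ) ⊕ rt ⊙ (Φ₃ γ ⋆ rest γ)))
             (+-cong (eval-⊙ ιz (t * t) (λ γ → Φ₁ γ ⋆ rest γ))
             (trans (eval-⊕ ιz (λ γ → u ⊙ (Φ₂ γ ⋆ rest γ)) (λ γ → rt ⊙ (Φ₃ γ ⋆ rest γ)))
             (+-cong (eval-⊙ ιz u (λ γ → Φ₂ γ ⋆ rest γ)) (eval-⊙ ιz rt (λ γ → Φ₃ γ ⋆ rest γ))))) ⟩
      (t * t) * eval ιz (λ γ → Φ₁ γ ⋆ rest γ) + (u * eval ιz (λ γ → Φ₂ γ ⋆ rest γ) + rt * eval ιz (λ γ → Φ₃ γ ⋆ rest γ))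
        ≈⟨ +-cong (*-congˡ (induction (good-weight torsionFree z Φ good (a 0))))
             (+-cong (*-congˡ (induction (good-size torsionFree z (a 0) Φ good)))
                     (*-congˡ (induction (good-sizedEdges torsionFree z (a 0) Φ good)))) ⟩
      (t * t) * 0# + (u * 0# + rt * 0#)
        ≈⟨ +-cong (zeroʳ _) (+-cong (zeroʳ _) (zeroʳ _)) ⟩
      0# + (0# + 0#)
        ≈⟨ trans (+-identityˡ _) (+-identityˡ _) ⟩
      0# ∎
      where
      open Expansion (r 0) (relation 0)
      rest Φ₁ Φ₂ Φ₃ : Family
      rest γ = ⋆< N (λ i → weight (r (suc i)) (a (suc i)) γ)
      Φ₁ γ = ι ∘ (Φ γ K⋆.⋆ KW.weight K.0# (a 0) γ)
      Φ₂ γ = ι ∘ (Φ γ K⋆.⋆ K⋆.size (a 0))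
      Φ₃ γ = ι ∘ (Φ γ K⋆.⋆ KW.sizedEdges (a 0) γ)
      induction : {Φ : KW.Family} → Good torsionFree z Φ → eval ιz (λ γ → (ι ∘ Φ γ) ⋆ rest γ) ≈ 0#
      induction {Φ} good = vanishing N (r ∘ suc) (relation ∘ suc) (a ∘ suc) Φ good
      expand : ∀ γ → (ι ∘ Φ γ) ⋆ weight (r 0) (a 0) γ ≋ (t * t) ⊙ Φ₁ γ ⊕ (u ⊙ Φ₂ γ ⊕ rt ⊙ Φ₃ γ)
      expand γ S = begin
        (ιΦ ⋆ weight (r 0) (a 0) γ) S
          ≈⟨ ⋆-cong (λ _ → refl) (weight-expansion (a 0) γ) S ⟩
        (ιΦ ⋆ ((t * t) ⊙ W ⊕ (u ⊙ s ⊕ rt ⊙ E))) S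
          ≈⟨ trans (⋆-distribˡ ιΦ _ _ S) (+-cong (⋆-⊙ (t * t) ιΦ W S)
               (trans (⋆-distribˡ ιΦ _ _ S) (+-cong (⋆-⊙ u ιΦ s S) (⋆-⊙ rt ιΦ E S)))) ⟩
        (t * t) * (ιΦ ⋆ W) S + (u * (ιΦ ⋆ s) S + rt * (ιΦ ⋆ E) S)
          ≈⟨ +-cong (*-congˡ (homo-⋆ (Φ γ) _ S)) (+-cong (*-congˡ (homo-⋆ (Φ γ) _ S)) (*-congˡ (homo-⋆ (Φ γ) _ S))) ⟨
        (t * t) * Φ₁ γ S + (u * Φ₂ γ S + rt * Φ₃ γ S) ∎
        where
        ιΦ = ι ∘ Φ γ
        W  = ι ∘ KW.weight K.0# (a 0) γ
        s  = ι ∘ K⋆.size (a 0)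
        E  = ι ∘ KW.sizedEdges (a 0) γ

-- Free modules and their linear functionals.

module FreeProperties (R : CommutativeRing c ℓ) (X : DecSetoid a b) where
  open CommutativeRing R
  open import Relation.Binary.Reasoning.Setoid setoid
  open Sums commutativeSemiring
  open Free rawRing X
  open RawLeftModule freeModule using () renaming (-ᴹ_ to negate)
  open DecSetoid X using (_≟_)
    renaming (Carrier to Gen; _≈_ to _≈ᵍ_; refl to ≈ᵍ-refl; sym to ≈ᵍ-sym; trans to ≈ᵍ-trans)
  open import Algebra.Properties.Ring ring using (-‿distribˡ-*; -‿+-comm; -0#≈0#; x∙y⁻¹≈ε⇒x≈y; x≈y⇒x∙y⁻¹≈ε)

  Respectful : (Gen → Carrier) → Set _
  Respectful h = ∀ {x y} → x ≈ᵍ y → h x ≈ h y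

  -- The linear functional with values `h` on generators. It is defined on lists of terms; its
  -- compatibility with equality of coefficients is `evaluate-respects`.
  evaluate : (Gen → Carrier) → Combination → Carrier
  evaluate h z = ∑ z (λ (k , y) → k * h y)

  evaluate-cong : {h h′ : Gen → Carrier} (z : Combination) → (∀ y → h y ≈ h′ y) → evaluate h z ≈ evaluate h′ z
  evaluate-cong z e = ∑-cong z λ (k , y) → *-congˡ (e y)

  evaluate-++ : (h : Gen → Carrier) (z w : Combination) → evaluate h (z ++ w) ≈ evaluate h z + evaluate h w
  evaluate-++ h = ∑-++ _

  evaluate-negate : (h : Gen → Carrier) (z : Combination) → evaluate h (negate z) ≈ - evaluate h z
  evaluate-negate h []            = sym -0#≈0#
  evaluate-negate h ((k , y) ∷ z) =
    trans (+-cong (sym (-‿distribˡ-* k (h y))) (evaluate-negate h z)) (-‿+-comm _ _)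

  δ : Gen → Gen → Carrier
  δ x y = if does (y ≟ x) then 1# else 0#

  δ-respectful : ∀ x → Respectful (δ x)
  δ-respectful x {y} {y′} e = reflexive (≡.cong (if_then 1# else 0#)
    (does-⇔ (mk⇔ (≈ᵍ-trans (≈ᵍ-sym e)) (≈ᵍ-trans e)) (y ≟ x) (y′ ≟ x)))

  coeff-evaluate : ∀ z x → coeff z x ≈ evaluate (δ x) z
  coeff-evaluate []            x = refl
  coeff-evaluate ((k , y) ∷ z) x with does (y ≟ x)
  ... | true  = +-cong (sym (*-identityʳ k)) (coeff-evaluate z x)
  ... | false = +-cong (sym (zeroʳ k)) (coeff-evaluate z x)

  private
    other? : (y : Gen) → Decidable {A = Carrier × Gen} (λ (_ , y′) → ¬ (y′ ≈ᵍ y))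
    other? y (_ , y′) = ¬? (y′ ≟ y)

  remove : Gen → Combination → Combination
  remove y = filter (other? y)

  evaluate-remove : {h : Gen → Carrier} → Respectful h → ∀ y z →
    evaluate h z ≈ coeff z y * h y + evaluate h (remove y z)
  evaluate-remove {h} respectful y [] = sym (trans (+-identityʳ _) (zeroˡ (h y)))
  evaluate-remove {h} respectful y ((k , y′) ∷ z) with y′ ≟ y
  ... | yes e = begin
    k * h y′ + evaluate h z
      ≈⟨ +-cong (*-congˡ (respectful e)) (evaluate-remove respectful y z) ⟩
    k * h y + (coeff z y * h y + evaluate h (remove y z))     ≈⟨ +-assoc _ _ _ ⟨
    (k * h y + coeff z y * h y) + evaluate h (remove y z)     ≈⟨ +-congʳ (distribʳ _ _ _) ⟨
    (k + coeff z y) * h y + evaluate h (remove y z)           ∎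
  ... | no _ = begin
    k * h y′ + evaluate h z                                   ≈⟨ +-congˡ (evaluate-remove respectful y z) ⟩
    k * h y′ + (coeff z y * h y + evaluate h (remove y z))    ≈⟨ x∙yz≈y∙xz _ _ _ ⟩
    coeff z y * h y + (k * h y′ + evaluate h (remove y z))    ≈⟨ +-congʳ (*-congʳ (+-identityˡ _)) ⟨
    (0# + coeff z y) * h y + (k * h y′ + evaluate h (remove y z)) ∎
    where open CommutativeSemigroupProperties +-commutativeSemigroup

  -- Induction on the number of terms: all those at one generator cancel
  -- and can be removed together.
  evaluate-null : {h : Gen → Carrier} → Respectful h → ∀ N z → length z ≤ N →
    (∀ x → coeff z x ≈ 0#) → evaluate h z ≈ 0#
  evaluate-null respectful N       []              _   null = refl
  evaluate-null {h} respectful (suc N) z@((k , y) ∷ z′) z≤N null = begin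
    evaluate h z                                ≈⟨ evaluate-remove respectful y z ⟩
    coeff z y * h y + evaluate h (remove y z)
      ≈⟨ +-cong (*-congʳ (null y)) (evaluate-null respectful N (remove y z) shorter null′) ⟩
    0# * h y + 0#                               ≈⟨ trans (+-identityʳ _) (zeroˡ _) ⟩
    0#                                          ∎
    where
    shorter : length (remove y z) ≤ N
    shorter = ℕ.≤-pred (ℕ.≤-trans (filter-notAll (other? y) z (here λ y≉y → y≉y ≈ᵍ-refl)) z≤N)
    -- The same splitting, applied to the coordinate functional `δ x`, shows that removing the terms
    -- at `y` changes no coefficient, since their total is zero.
    null′ : ∀ x → coeff (remove y z) x ≈ 0#
    null′ x = begin
      coeff (remove y z) x                          ≈⟨ coeff-evaluate (remove y z) x ⟩
      evaluate (δ x) (remove y z)                   ≈⟨ +-identityˡ _ ⟨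
      0# + evaluate (δ x) (remove y z)              ≈⟨ +-congʳ (trans (*-congʳ (null y)) (zeroˡ _)) ⟨
      coeff z y * δ x y + evaluate (δ x) (remove y z) ≈⟨ evaluate-remove (δ-respectful x) y z ⟨
      evaluate (δ x) z                              ≈⟨ coeff-evaluate z x ⟨
      coeff z x                                     ≈⟨ null x ⟩
      0#                                            ∎

  private
    difference : (h : Gen → Carrier) (z w : Combination) → evaluate h (z ++ negate w) ≈ evaluate h z - evaluate h w
    difference h z w = trans (evaluate-++ h z (negate w)) (+-congˡ (evaluate-negate h w))

  evaluate-respects : {h : Gen → Carrier} → Respectful h → ∀ z w →
    (∀ x → coeff z x ≈ coeff w x) → evaluate h z ≈ evaluate h w
  evaluate-respects {h} respectful z w z≈w = x∙y⁻¹≈ε⇒x≈y _ _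
    (trans (sym (difference h z w)) (evaluate-null respectful _ (z ++ negate w) ℕ.≤-refl null))
    where
    null : ∀ x → coeff (z ++ negate w) x ≈ 0#
    null x = begin
      coeff (z ++ negate w) x               ≈⟨ coeff-evaluate (z ++ negate w) x ⟩
      evaluate (δ x) (z ++ negate w)        ≈⟨ difference (δ x) z w ⟩
      evaluate (δ x) z - evaluate (δ x) w   ≈⟨ +-cong (coeff-evaluate z x) (-‿cong (coeff-evaluate w x)) ⟨
      coeff z x - coeff w x                 ≈⟨ x≈y⇒x∙y⁻¹≈ε (z≈w x) ⟩
      0#                                    ∎

  -- The functionals `δ x` read off the coefficients. Testing against all respectful `h` reduces
  -- polynomial identities to identities of monomials, without normal forms for lists of terms.
  evaluate-ext : ∀ z w → (∀ h → Respectful h → evaluate h z ≈ evaluate h w) → ∀ x → coeff z x ≈ coeff w x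
  evaluate-ext z w e x =
    trans (coeff-evaluate z x) (trans (e (δ x) (δ-respectful x)) (sym (coeff-evaluate w x)))

-- The quotient by an ideal as a commutative ring.

module QuotientProperties (R : CommutativeRing c ℓ) {I : Set a} (g : I → CommutativeRing.Carrier R) where
  open CommutativeRing R hiding (zero)
  open import Relation.Binary.Reasoning.Setoid setoid
  open import Algebra.Properties.Ring ring
    using (-‿distribʳ-*; -1*x≈-x; -‿+-comm; -‿involutive; x≈y⇒x∙y⁻¹≈ε; -0#≈0#)
  open CommutativeSemigroupProperties +-commutativeSemigroup using () renaming (interchange to +-interchange)
  open Quotient rawRing g

  infix 4 _∼_
  _∼_ : Carrier → Carrier → Set _
  x ∼ y = Ideal (x - y)

  ≈⇒∼ : ∀ {x y} → x ≈ y → x ∼ y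
  ≈⇒∼ x≈y = respect (sym (x≈y⇒x∙y⁻¹≈ε x≈y)) zero

  Ideal⇒∼0 : ∀ {x} → Ideal x → x ∼ 0#
  Ideal⇒∼0 = respect (sym (trans (+-congˡ -0#≈0#) (+-identityʳ _)))

  private
    Ideal-neg : ∀ {x} → Ideal x → Ideal (- x)
    Ideal-neg i = respect (-1*x≈-x _) (multiply (- 1#) i)

    telescope : ∀ x y z → (x - y) + (y - z) ≈ x - z
    telescope x y z = begin
      (x - y) + (y - z)      ≈⟨ +-assoc _ _ _ ⟩
      x + (- y + (y - z))    ≈⟨ +-congˡ (+-assoc _ _ _) ⟨
      x + ((- y + y) - z)    ≈⟨ +-congˡ (trans (+-congʳ (-‿inverseˡ y)) (+-identityˡ _)) ⟩
      x - z                  ∎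

    *-difference : ∀ k x y → k * (x - y) ≈ k * x - k * y
    *-difference k x y = trans (distribˡ k x (- y)) (+-congˡ (sym (-‿distribʳ-* k y)))

  ∼-refl : ∀ {x} → x ∼ x
  ∼-refl = ≈⇒∼ refl

  ∼-sym : ∀ {x y} → x ∼ y → y ∼ x
  ∼-sym {x} {y} i = respect (begin
    - (x - y)      ≈⟨ -‿+-comm x (- y) ⟨
    - x - - y      ≈⟨ +-congˡ (-‿involutive y) ⟩
    - x + y        ≈⟨ +-comm _ _ ⟩
    y - x          ∎) (Ideal-neg i)

  ∼-trans : ∀ {x y z} → x ∼ y → y ∼ z → x ∼ z
  ∼-trans i j = respect (telescope _ _ _) (add i j)

  +-cong-∼ : ∀ {x y u v} → x ∼ y → u ∼ v → x + u ∼ y + v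
  +-cong-∼ i j = respect (trans (+-interchange _ _ _ _) (+-congˡ (-‿+-comm _ _))) (add i j)

  -- The difference is u (x - y) + y (u - v), a combination of members of the ideal.
  *-cong-∼ : ∀ {x y u v} → x ∼ y → u ∼ v → x * u ∼ y * v
  *-cong-∼ {x} {y} {u} {v} i j = respect (begin
    u * (x - y) + y * (u - v)            ≈⟨ +-cong (*-difference u x y) (*-difference y u v) ⟩
    (u * x - u * y) + (y * u - y * v)    ≈⟨ +-congʳ (+-cong (*-comm u x) (-‿cong (*-comm u y))) ⟩
    (x * u - y * u) + (y * u - y * v)    ≈⟨ telescope _ _ _ ⟩
    x * u - y * v                        ∎) (add (multiply u i) (multiply y j))

  quotientRing : CommutativeRing _ _
  quotientRing = record
    { RawRing quotient
    ; isCommutativeRing = record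
      { isRing = record
        { +-isAbelianGroup = record
          { isGroup = record
            { isMonoid = record
              { isSemigroup = record
                { isMagma = record
                  { isEquivalence = record { refl = ∼-refl ; sym = ∼-sym ; trans = ∼-trans }
                  ; ∙-cong = +-cong-∼
                  }
                ; assoc = λ x y z → ≈⇒∼ (+-assoc x y z)
                }
              ; identity = (λ x → ≈⇒∼ (+-identityˡ x)) , (λ x → ≈⇒∼ (+-identityʳ x))
              }
            ; inverse = (λ x → ≈⇒∼ (-‿inverseˡ x)) , (λ x → ≈⇒∼ (-‿inverseʳ x))
            ; ⁻¹-cong = λ i → respect (sym (-‿+-comm _ _)) (Ideal-neg i)
            }
          ; comm = λ x y → ≈⇒∼ (+-comm x y)
          }
        ; *-cong = *-cong-∼
        ; *-assoc = λ x y z → ≈⇒∼ (*-assoc x y z)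
        ; *-identity = (λ x → ≈⇒∼ (*-identityˡ x)) , (λ x → ≈⇒∼ (*-identityʳ x))
        ; distrib = (λ x y z → ≈⇒∼ (distribˡ x y z)) , (λ x y z → ≈⇒∼ (distribʳ x y z))
        }
      ; *-comm = λ x y → ≈⇒∼ (*-comm x y)
      }
    }

-- The polynomial ring as a commutative ring.

module Polynomials (K : HeytingField a b c) where
  𝕂 : CommutativeRing a b
  𝕂 = HeytingCommutativeRing.commutativeRing (HeytingField.heytingCommutativeRing K)

  open CommutativeRing 𝕂 hiding (zero)
  open import Relation.Binary.Reasoning.Setoid setoid
  open RawMonoid monomialMonoid using (_∙_; ε)
  open RawRing (polynomialRing K) using ()
    renaming (Carrier to Polynomial; _≈_ to _≈ᴾ_; _+_ to _+ᴾ_; _*_ to _*ᴾ_; -_ to -ᴾ_; 0# to 0ᴾ; 1# to 1ᴾ)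
  open FreeProperties 𝕂 monomials
  open Free rawRing monomials using (coeff)
  open Sums commutativeSemiring

  ∙-congˡ : ∀ x {y y′} → y ≈ᴹᵒ y′ → (x ∙ y) ≈ᴹᵒ (x ∙ y′)
  ∙-congˡ x e i = ≡.cong (exponent x i ℕ.+_) (e i)

  ∙-congʳ : ∀ y {x x′} → x ≈ᴹᵒ x′ → (x ∙ y) ≈ᴹᵒ (x′ ∙ y)
  ∙-congʳ y e i = ≡.cong (ℕ._+ exponent y i) (e i)

  -- A product turns into a nested evaluation, after which the multiplicative laws come from those
  -- of monomials and from exchanging sums.
  evaluate-* : (h : Monomial → Carrier) (p q : Polynomial) →
    evaluate h (p *ᴾ q) ≈ evaluate (λ x → evaluate (λ y → h (x ∙ y)) q) p
  evaluate-* h p q = begin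
    evaluate h (p *ᴾ q)
      ≈⟨ ∑-cartesianProductWith (λ (k , x) → k * h x) (λ (k , x) (l , y) → (k * l , x ∙ y)) p q ⟩
    ∑ p (λ (k , x) → ∑ q (λ (l , y) → (k * l) * h (x ∙ y)))
      ≈⟨ ∑-cong p (λ (k , x) → trans (∑-cong q λ (l , y) → *-assoc k l _) (∑-*ˡ k _ q)) ⟩
    evaluate (λ x → evaluate (λ y → h (x ∙ y)) q) p ∎

  evaluate-swap : (h : Monomial → Monomial → Carrier) (p q : Polynomial) →
    evaluate (λ x → evaluate (h x) q) p ≈ evaluate (λ y → evaluate (λ x → h x y) p) q
  evaluate-swap h p q = begin
    ∑ p (λ (k , x) → k * ∑ q (λ (l , y) → l * h x y))   ≈⟨ ∑-cong p (λ (k , x) → ∑-*ˡ k _ q) ⟨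
    ∑ p (λ (k , x) → ∑ q (λ (l , y) → k * (l * h x y))) ≈⟨ ∑-swap _ p q ⟩
    ∑ q (λ (l , y) → ∑ p (λ (k , x) → k * (l * h x y)))
      ≈⟨ ∑-cong q (λ (l , y) → trans (∑-cong p λ (k , x) → x∙yz≈y∙xz k l _) (∑-*ˡ l _ p)) ⟩
    ∑ q (λ (l , y) → l * ∑ p (λ (k , x) → k * h x y))   ∎
    where open CommutativeSemigroupProperties *-commutativeSemigroup

  *ᴾ-comm : ∀ p q → p *ᴾ q ≈ᴾ q *ᴾ p
  *ᴾ-comm p q = evaluate-ext (p *ᴾ q) (q *ᴾ p) λ h respectful → begin
    evaluate h (p *ᴾ q)                               ≈⟨ evaluate-* h p q ⟩
    evaluate (λ x → evaluate (λ y → h (x ∙ y)) q) p   ≈⟨ evaluate-swap _ p q ⟩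
    evaluate (λ y → evaluate (λ x → h (x ∙ y)) p) q
      ≈⟨ evaluate-cong q (λ y → evaluate-cong p λ x → respectful λ i → ℕ.+-comm (exponent x i) (exponent y i)) ⟩
    evaluate (λ y → evaluate (λ x → h (y ∙ x)) p) q   ≈⟨ evaluate-* h q p ⟨
    evaluate h (q *ᴾ p)                               ∎

  *ᴾ-cong : ∀ p p′ q q′ → p ≈ᴾ p′ → q ≈ᴾ q′ → p *ᴾ q ≈ᴾ p′ *ᴾ q′
  *ᴾ-cong p p′ q q′ p≈p′ q≈q′ = evaluate-ext (p *ᴾ q) (p′ *ᴾ q′) λ h respectful → begin
    evaluate h (p *ᴾ q)
      ≈⟨ evaluate-* h p q ⟩
    evaluate (λ x → evaluate (λ y → h (x ∙ y)) q) p
      ≈⟨ evaluate-cong p (λ x → evaluate-respects (λ {y} {y′} e → respectful (∙-congˡ x {y} {y′} e)) q q′ q≈q′) ⟩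
    evaluate (λ x → evaluate (λ y → h (x ∙ y)) q′) p
      ≈⟨ evaluate-respects (λ {x} {x′} e → evaluate-cong q′ λ y → respectful (∙-congʳ y {x} {x′} e)) p p′ p≈p′ ⟩
    evaluate (λ x → evaluate (λ y → h (x ∙ y)) q′) p′
      ≈⟨ evaluate-* h p′ q′ ⟨
    evaluate h (p′ *ᴾ q′) ∎

  *ᴾ-assoc : ∀ p q r → (p *ᴾ q) *ᴾ r ≈ᴾ p *ᴾ (q *ᴾ r)
  *ᴾ-assoc p q r = evaluate-ext ((p *ᴾ q) *ᴾ r) (p *ᴾ (q *ᴾ r)) λ h respectful → begin
    evaluate h ((p *ᴾ q) *ᴾ r)
      ≈⟨ evaluate-* h (p *ᴾ q) r ⟩
    evaluate (λ w → evaluate (λ z → h (w ∙ z)) r) (p *ᴾ q)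
      ≈⟨ evaluate-* _ p q ⟩
    evaluate (λ x → evaluate (λ y → evaluate (λ z → h ((x ∙ y) ∙ z)) r) q) p
      ≈⟨ evaluate-cong p (λ x → evaluate-cong q λ y → evaluate-cong r λ z →
           respectful λ i → ℕ.+-assoc (exponent x i) (exponent y i) (exponent z i)) ⟩
    evaluate (λ x → evaluate (λ y → evaluate (λ z → h (x ∙ (y ∙ z))) r) q) p
      ≈⟨ evaluate-cong p (λ x → evaluate-* (λ w → h (x ∙ w)) q r) ⟨
    evaluate (λ x → evaluate (λ w → h (x ∙ w)) (q *ᴾ r)) p
      ≈⟨ evaluate-* h p (q *ᴾ r) ⟨
    evaluate h (p *ᴾ (q *ᴾ r)) ∎

  *ᴾ-identityˡ : ∀ p → 1ᴾ *ᴾ p ≈ᴾ p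
  *ᴾ-identityˡ p = evaluate-ext (1ᴾ *ᴾ p) p λ h respectful → begin
    evaluate h (1ᴾ *ᴾ p)                         ≈⟨ evaluate-* h 1ᴾ p ⟩
    1# * evaluate (λ y → h (ε ∙ y)) p + 0#       ≈⟨ trans (+-identityʳ _) (*-identityˡ _) ⟩
    evaluate (λ y → h (ε ∙ y)) p                 ≈⟨ evaluate-cong p (λ y → respectful λ _ → ≡.refl) ⟩
    evaluate h p                                 ∎

  *ᴾ-distribʳ : ∀ r p q → (p +ᴾ q) *ᴾ r ≈ᴾ (p *ᴾ r) +ᴾ (q *ᴾ r)
  *ᴾ-distribʳ r p q = evaluate-ext ((p +ᴾ q) *ᴾ r) ((p *ᴾ r) +ᴾ (q *ᴾ r)) λ h _ → begin
    evaluate h ((p +ᴾ q) *ᴾ r)                                        ≈⟨ evaluate-* h (p +ᴾ q) r ⟩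
    evaluate (λ x → evaluate (λ y → h (x ∙ y)) r) (p +ᴾ q)            ≈⟨ evaluate-++ _ p q ⟩
    evaluate (λ x → evaluate (λ y → h (x ∙ y)) r) p + evaluate (λ x → evaluate (λ y → h (x ∙ y)) r) q
      ≈⟨ +-cong (evaluate-* h p r) (evaluate-* h q r) ⟨
    evaluate h (p *ᴾ r) + evaluate h (q *ᴾ r)                         ≈⟨ evaluate-++ h (p *ᴾ r) (q *ᴾ r) ⟨
    evaluate h ((p *ᴾ r) +ᴾ (q *ᴾ r))                                 ∎

  coeff-+ : ∀ p q x → coeff (p +ᴾ q) x ≈ coeff p x + coeff q x
  coeff-+ p q x = ∑-++ (λ (k , y) → if does (y ≟ᴹᵒ x) then k else 0#) p q

  +ᴾ-cong : ∀ p p′ q q′ → p ≈ᴾ p′ → q ≈ᴾ q′ → p +ᴾ q ≈ᴾ p′ +ᴾ q′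
  +ᴾ-cong p p′ q q′ e f x =
    trans (coeff-+ p q x) (trans (+-cong (e x) (f x)) (sym (coeff-+ p′ q′ x)))

  +ᴾ-comm : ∀ p q → p +ᴾ q ≈ᴾ q +ᴾ p
  +ᴾ-comm p q x = trans (coeff-+ p q x) (trans (+-comm _ _) (sym (coeff-+ q p x)))

  coeff-neg : ∀ p x → coeff (-ᴾ p) x ≈ - coeff p x
  coeff-neg p x = begin
    coeff (-ᴾ p) x           ≈⟨ coeff-evaluate (-ᴾ p) x ⟩
    evaluate (δ x) (-ᴾ p)    ≈⟨ evaluate-negate (δ x) p ⟩
    - evaluate (δ x) p       ≈⟨ -‿cong (coeff-evaluate p x) ⟨
    - coeff p x              ∎

  -ᴾ-inverseˡ : ∀ p → (-ᴾ p) +ᴾ p ≈ᴾ 0ᴾ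
  -ᴾ-inverseˡ p x = trans (coeff-+ (-ᴾ p) p x) (trans (+-congʳ (coeff-neg p x)) (-‿inverseˡ (coeff p x)))

  -ᴾ-inverseʳ : ∀ p → p +ᴾ (-ᴾ p) ≈ᴾ 0ᴾ
  -ᴾ-inverseʳ p x = trans (coeff-+ p (-ᴾ p) x) (trans (+-congˡ (coeff-neg p x)) (-‿inverseʳ (coeff p x)))

  ℙ : CommutativeRing _ _
  ℙ = record
    { RawRing (polynomialRing K)
    ; isCommutativeRing = record
      { isRing = record
        { +-isAbelianGroup = record
          { isGroup = record
            { isMonoid = record
              { isSemigroup = record
                { isMagma = record
                  { isEquivalence = record
                    { refl  = λ _ → refl
                    ; sym   = λ e x → sym (e x)
                    ; trans = λ e f x → trans (e x) (f x)
                    }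
                  ; ∙-cong = λ {p} {p′} {q} {q′} → +ᴾ-cong p p′ q q′
                  }
                ; assoc = λ p q r x → reflexive (≡.cong (λ s → coeff s x) (++-assoc p q r))
                }
              ; identity = (λ _ _ → refl) , (λ p x → reflexive (≡.cong (λ s → coeff s x) (++-identityʳ p)))
              }
            ; inverse = -ᴾ-inverseˡ , -ᴾ-inverseʳ
            ; ⁻¹-cong = λ {p} {q} e x → trans (coeff-neg p x) (trans (-‿cong (e x)) (sym (coeff-neg q x)))
            }
          ; comm = +ᴾ-comm
          }
        ; *-cong = λ {p} {p′} {q} {q′} → *ᴾ-cong p p′ q q′
        ; *-assoc = *ᴾ-assoc
        ; *-identity = *ᴾ-identityˡ , λ p x → trans (*ᴾ-comm p 1ᴾ x) (*ᴾ-identityˡ p x)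
        ; distrib =
            (λ r p q x → trans (*ᴾ-comm r (p +ᴾ q) x) (trans (*ᴾ-distribʳ r p q x)
              (+ᴾ-cong (p *ᴾ r) (r *ᴾ p) (q *ᴾ r) (r *ᴾ q) (*ᴾ-comm p r) (*ᴾ-comm q r) x)))
          , *ᴾ-distribʳ
        }
      ; *-comm = *ᴾ-comm
      }
    }

-- Coefficients as convolutions over the colours.

module ColouringExpansion (A : CommutativeSemiring c ℓ) where
  open CommutativeSemiring A hiding (zero)
  open import Relation.Binary.Reasoning.Setoid setoid
  open Exponentiation semiring
  open Convolution A
  open Sums A
  open Weights A

  size-length : ∀ a (S : List V) → length S ≡ a → size a S ≈ 1#
  size-length zero    []      _ = refl
  size-length (suc a) (_ ∷ S) e = size-length a S (ℕ.suc-injective e)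

  size-other : ∀ a (S : List V) → length S ≢ a → size a S ≈ 0#
  size-other zero    []      0≢0 = contradiction ≡.refl 0≢0
  size-other zero    (_ ∷ _) _   = refl
  size-other (suc a) []      _   = refl
  size-other (suc a) (_ ∷ S) e   = size-other a S (e ∘ ≡.cong suc)

  ∏<-zero : ∀ N (ψ : ℕ → Carrier) i → i < N → ψ i ≈ 0# → ∏< N ψ ≈ 0#
  ∏<-zero (suc N) ψ zero    _           e = trans (*-congʳ e) (zeroˡ _)
  ∏<-zero (suc N) ψ (suc i) (ℕ.s≤s i<N) e = trans (*-congˡ (∏<-zero N (ψ ∘ suc) i i<N e)) (zeroʳ _)

  if-dec : {P : Set p} {k x : Carrier} (P? : Dec P) → (P → k ≈ x) → (¬ P → x ≈ 0#) →
    (if does P? then k else 0#) ≈ x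
  if-dec (yes p) e f = e p
  if-dec (no ¬p) e f = sym (f ¬p)

  module _ (q : ℕ → Carrier) (G : Graph n) (x : Monomial) where

    -- If `xᶠ f` is `x`, every class has the prescribed size and only the powers of q remain.
    -- Otherwise a class below the bound has the wrong size and kills the product: from the bound
    -- on, classes are empty and the exponents of `x` are zero, so no difference can hide there.
    colouring-weight : (f : Colouring n) → (∀ v → f v < bound x) →
      (if does (xᶠ f ≟ᴹᵒ x) then ∏< (bound x) (λ i → q i ^ monochromatic G f i) else 0#)
        ≈ ∏< (bound x) (λ i → weight (q i) (exponent x i) (n , G) (colourClass id f i))
    colouring-weight f f< = if-dec (xᶠ f ≟ᴹᵒ x)
      (λ e → ∏<-cong (bound x) λ i → sym (trans
        (*-congʳ (size-length (exponent x i) (colourClass id f i) (≡.trans (length-colourClass id f i) (e i))))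
        (trans (*-identityˡ _) (^-congʳ (q i) (edgeCount-colourClass G f i)))))
      different
      where
      different : ¬ (xᶠ f ≈ᴹᵒ x) → ∏< (bound x) (λ i → weight (q i) (exponent x i) (n , G) (colourClass id f i)) ≈ 0#
      different ne with ℕ.anyUpTo? (λ i → ¬? (exponent (xᶠ f) i ℕ.≟ exponent x i)) (bound x)
      ... | yes (i , i<N , differ) = ∏<-zero (bound x) _ i i<N (trans
        (*-congʳ (size-other (exponent x i) (colourClass id f i) (differ ∘ ≡.trans (≡.sym (length-colourClass id f i)))))
        (zeroˡ _))
      ... | no none = contradiction equal ne
        where
        equal : xᶠ f ≈ᴹᵒ x
        equal i with i ℕ.<? bound x
        ... | yes i<N = decidable-stable (exponent (xᶠ f) i ℕ.≟ exponent x i) λ differ → none (i , i<N , differ)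
        ... | no  i≮N = ≡.trans
          (≡.trans (≡.sym (length-colourClass id f i))
            (≡.cong length (colourClass-unused id f i λ v → ℕ.<⇒≢ (ℕ.<-≤-trans (f< v) (ℕ.≮⇒≥ i≮N)))))
          (≡.sym (vanishes x i (ℕ.≮⇒≥ i≮N)))

    -- The factorisation of `w` is asked only for colourings below the bound, as the finite product
    -- sees no colours beyond it.
    ∑-weighted-colourings : (w : Colouring n → Carrier) →
      (∀ f → (∀ v → f v < bound x) → w f ≈ ∏< (bound x) (λ i → q i ^ monochromatic G f i)) →
      ∑ (filter (λ f → U? f ×-dec (xᶠ f ≟ᴹᵒ x)) (colouringsBelow (bound x) n)) w
        ≈ ⋆< (bound x) (λ i → weight (q i) (exponent x i) (n , G)) (allFin n)
    ∑-weighted-colourings w w≈ = begin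
      ∑ (filter (λ f → U? f ×-dec (xᶠ f ≟ᴹᵒ x)) (colouringsBelow (bound x) n)) w
        ≈⟨ ∑-filter (λ f → U? f ×-dec (xᶠ f ≟ᴹᵒ x)) w (colouringsBelow (bound x) n) ⟩
      ∑ (colouringsBelow (bound x) n) (λ f → if does (xᶠ f ≟ᴹᵒ x) then w f else 0#)
        ≈⟨ ∑-cong-All (All.map (λ {f} f< → trans (if-cong (does (xᶠ f ≟ᴹᵒ x)) (w≈ f f<)) (colouring-weight f f<))
             (colouringsBelow-< (bound x) n)) ⟩
      ∑ (colouringsBelow (bound x) n) (λ f → ∏< (bound x) (λ i →
        weight (q i) (exponent x i) (n , G) (colourClass id f i)))
        ≈⟨ ∑-colourings (bound x) id (λ i → weight (q i) (exponent x i) (n , G)) ⟩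
      ⋆< (bound x) (λ i → weight (q i) (exponent x i) (n , G)) (allFin n) ∎
      where
      if-cong : ∀ b {k l} → k ≈ l → (if b then k else 0#) ≈ (if b then l else 0#)
      if-cong true  e = e
      if-cong false e = refl

-- Monomials as products of powers of variables.

module MonomialProducts where
  open RawMonoid monomialMonoid using (_∙_; ε)
  open RawMonoidDefs monomialMonoid using () renaming (_×_ to _⋅_)
  open ℕSums

  exponent-⋅ : ∀ k x j → exponent (k ⋅ x) j ≡ k ℕ.* exponent x j
  exponent-⋅ zero    x j = ≡.refl
  exponent-⋅ (suc k) x j = ≡.cong (exponent x j ℕ.+_) (exponent-⋅ k x j)

  exponent-big : ∀ N (ψ : ℕ → Monomial) j → exponent (big _∙_ ε N ψ) j ≡ ∑< N (λ i → exponent (ψ i) j)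
  exponent-big zero    ψ j = ≡.refl
  exponent-big (suc N) ψ j = ≡.cong (exponent (ψ 0) j ℕ.+_) (exponent-big N (ψ ∘ suc) j)

  ∑<-zero : ∀ N {ψ : ℕ → ℕ} → (∀ i → ψ i ≡ 0) → ∑< N ψ ≡ 0
  ∑<-zero zero    e = ≡.refl
  ∑<-zero (suc N) e = ≡.cong₂ ℕ._+_ (e 0) (∑<-zero N (e ∘ suc))

  -- Both indices are shifted together: `var (suc i)` at `suc j` computes to `var i` at `j`. The
  -- hypothesis covers the indices that the sum does not reach.
  ∑<-var : ∀ N (e : ℕ → ℕ) j → (N ≤ j → e j ≡ 0) → ∑< N (λ i → e i ℕ.* exponent (var i) j) ≡ e j
  ∑<-var zero    e j       small = ≡.sym (small ℕ.z≤n)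
  ∑<-var (suc N) e zero    small = ≡.trans
    (≡.cong₂ ℕ._+_ (ℕ.*-identityʳ (e 0)) (∑<-zero N λ i → ℕ.*-zeroʳ (e (suc i)))) (ℕ.+-identityʳ (e 0))
  ∑<-var (suc N) e (suc j) small = ≡.cong₂ ℕ._+_ (ℕ.*-zeroʳ (e 0)) (∑<-var N (e ∘ suc) j (small ∘ ℕ.s≤s))

  exponent-product : ∀ N (e : ℕ → ℕ) j → (N ≤ j → e j ≡ 0) →
    exponent (big _∙_ ε N (λ i → e i ⋅ var i)) j ≡ e j
  exponent-product N e j small = ≡.trans (exponent-big N (λ i → e i ⋅ var i) j)
    (≡.trans (∑<-cong N λ i → exponent-⋅ (e i) (var i) j) (∑<-var N e j small))

-- Constants, monomials and evaluation at q = 0 in the coefficient ring.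

module AugmentedRing (K : HeytingField a b c) where
  open Polynomials K public
  open RawMonoid monomialMonoid using (_∙_; ε)
  open RawMonoidDefs monomialMonoid using () renaming (_×_ to _⋅_)
  private
    module 𝕂 = CommutativeRing 𝕂
    module ℙ = CommutativeRing ℙ
    module Quot = QuotientProperties ℙ (relator K)
  open Quot using (≈⇒∼; Ideal⇒∼0)
  open Quotient ℙ.rawRing (relator K)
  open FreeProperties 𝕂 monomials
  open Free 𝕂.rawRing monomials using (coeff)
  open RawLeftModule (Free.freeModule 𝕂.rawRing monomials) using (_*ₗ_)

  𝔸 : CommutativeRing _ _
  𝔸 = Quot.quotientRing

  private module 𝔸 = CommutativeRing 𝔸

  constant : 𝕂.Carrier → ℙ.Carrier
  constant k = (k , ε) ∷ []

  monomial : Monomial → ℙ.Carrier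
  monomial x = (𝕂.1# , x) ∷ []

  constant-isHom : IsHomomorphism 𝕂.commutativeSemiring 𝔸.commutativeSemiring constant
  constant-isHom = record
    { isNearSemiringHomomorphism = record
      { +-isMonoidHomomorphism = record
        { isMagmaHomomorphism = record
          { isRelHomomorphism = record { cong = λ {k} {l} e → lift (constant k) (constant l) (respectful e) }
          -- One side is a list with one term, the other a list with two; they agree as polynomials,
          -- hence the comparison of evaluations.
          ; homo = λ k l → lift (constant (k 𝕂.+ l)) (constant k ℙ.+ constant l) λ h _ →
              𝕂.trans (𝕂.+-congʳ (𝕂.distribʳ (h ε) k l)) (𝕂.+-assoc _ _ _)
          }
        ; ε-homo = lift (constant 𝕂.0#) [] λ h _ → 𝕂.trans (𝕂.+-identityʳ _) (𝕂.zeroˡ (h ε))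
        }
      ; *-homo = λ k l → lift (constant (k 𝕂.* l)) (constant k ℙ.* constant l) λ h respects →
          𝕂.+-congʳ (𝕂.*-congˡ (respects λ _ → ≡.refl))
      }
    ; 1#-homo = 𝔸.refl {ℙ.1#}
    }
    where
    lift : ∀ p q → (∀ h → Respectful h → evaluate h p 𝕂.≈ evaluate h q) → p 𝔸.≈ q
    lift p q e = ≈⇒∼ {p} {q} (evaluate-ext p q e)
    respectful : ∀ {k l} → k 𝕂.≈ l → ∀ h → Respectful h → evaluate h (constant k) 𝕂.≈ evaluate h (constant l)
    respectful e h _ = 𝕂.+-congʳ (𝕂.*-congʳ e)

  -- Ψ̃ is extended linearly by the scalar action, while `eval` multiplies by ring elements; this
  -- passes from one to the other.
  *ₗ-constant : ∀ k p → k *ₗ p ℙ.≈ constant k ℙ.* p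
  *ₗ-constant k p = evaluate-ext (k *ₗ p) (constant k ℙ.* p) λ h respectful → begin
    evaluate h (k *ₗ p)                              ≡⟨ ∑-map (λ (k , x) → k 𝕂.* h x) (λ (l , x) → (k 𝕂.* l , x)) p ⟩
    ∑ p (λ (l , x) → (k 𝕂.* l) 𝕂.* h x)              ≈⟨ ∑-cong p (λ (l , x) → 𝕂.*-assoc k l (h x)) ⟩
    ∑ p (λ (l , x) → k 𝕂.* (l 𝕂.* h x))              ≈⟨ ∑-*ˡ k (λ (l , x) → l 𝕂.* h x) p ⟩
    k 𝕂.* evaluate h p                               ≈⟨ 𝕂.*-congˡ (evaluate-cong p λ x → respectful λ _ → ≡.refl) ⟩
    k 𝕂.* evaluate (λ x → h (ε ∙ x)) p               ≈⟨ 𝕂.+-identityʳ _ ⟨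
    k 𝕂.* evaluate (λ x → h (ε ∙ x)) p 𝕂.+ 𝕂.0#      ≈⟨ evaluate-* h (constant k) p ⟨
    evaluate h (constant k ℙ.* p)                    ∎
    where
    open import Relation.Binary.Reasoning.Setoid 𝕂.setoid
    open Sums 𝕂.commutativeSemiring

  *ₗ-constant-𝔸 : ∀ k p → k *ₗ p 𝔸.≈ constant k 𝔸.* p
  *ₗ-constant-𝔸 k p = ≈⇒∼ {k *ₗ p} {constant k ℙ.* p} (*ₗ-constant k p)

  atZero-constant : ∀ k → coeff (constant k) ε 𝕂.≈ k
  atZero-constant k = 𝕂.trans (𝕂.+-identityʳ _)
    (𝕂.reflexive (≡.cong (if_then k else 𝕂.0#) (dec-true (ε ≟ᴹᵒ ε) λ _ → ≡.refl)))

  monomial-cong : ∀ x y → x ≈ᴹᵒ y → monomial x 𝔸.≈ monomial y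
  monomial-cong x y e = ≈⇒∼ {monomial x} {monomial y} (evaluate-ext (monomial x) (monomial y) λ h respectful →
    𝕂.+-congʳ (𝕂.*-congˡ (respectful e)))

  monomial-∙ : ∀ x y → monomial (x ∙ y) 𝔸.≈ monomial x 𝔸.* monomial y
  monomial-∙ x y = ≈⇒∼ {monomial (x ∙ y)} {monomial x ℙ.* monomial y}
    (evaluate-ext (monomial (x ∙ y)) (monomial x ℙ.* monomial y) λ h _ →
      𝕂.+-congʳ (𝕂.*-congʳ (𝕂.sym (𝕂.*-identityˡ 𝕂.1#))))

  module _ where
    open Exponentiation 𝔸.semiring
    open Sums 𝔸.commutativeSemiring using (∏<)
    open MonomialProducts
    open ≈-Reasoning 𝔸.setoid

    monomial-^ : ∀ x k → monomial (k ⋅ x) 𝔸.≈ monomial x ^ k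
    monomial-^ x zero    = 𝔸.refl {𝔸.1#}
    monomial-^ x (suc k) = begin
      monomial (x ∙ (k ⋅ x))              ≈⟨ monomial-∙ x (k ⋅ x) ⟩
      monomial x 𝔸.* monomial (k ⋅ x)     ≈⟨ 𝔸.*-congˡ {monomial x} {monomial (k ⋅ x)} {monomial x ^ k} (monomial-^ x k) ⟩
      monomial x 𝔸.* monomial x ^ k       ∎

    monomial-big : ∀ N (r : ℕ → Monomial) (e : ℕ → ℕ) →
      monomial (big _∙_ ε N (λ i → e i ⋅ r i)) 𝔸.≈ ∏< N (λ i → monomial (r i) ^ e i)
    monomial-big zero    r e = 𝔸.refl {𝔸.1#}
    monomial-big (suc N) r e = begin
      monomial (x ∙ y)               ≈⟨ monomial-∙ x y ⟩
      monomial x 𝔸.* monomial y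
        ≈⟨ 𝔸.*-cong {monomial x} {monomial (r 0) ^ e 0} {monomial y} {rest}
             (monomial-^ (r 0) (e 0)) (monomial-big N (r ∘ suc) (e ∘ suc)) ⟩
      monomial (r 0) ^ e 0 𝔸.* rest  ∎
      where
      x = e 0 ⋅ r 0
      y = big _∙_ ε N (λ i → e (suc i) ⋅ r (suc i))
      rest = ∏< N (λ i → monomial (r (suc i)) ^ e (suc i))

    -- `N` may differ from the recorded bound: for `qᶠ G f` that bound is `colourBound f`, while the
    -- product has to run up to the bound of the monomial whose coefficient is taken.
    monomial-∏ : ∀ N x → (∀ j → N ≤ j → exponent x j ≡ 0) →
      monomial x 𝔸.≈ ∏< N (λ i → monomial (var i) ^ exponent x i)
    monomial-∏ N x small = begin
      monomial x
        ≈⟨ monomial-cong x product (λ j → ≡.sym (exponent-product N (exponent x) j (small j))) ⟩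
      monomial product
        ≈⟨ monomial-big N var (exponent x) ⟩
      ∏< N (λ i → monomial (var i) ^ exponent x i) ∎
      where product = big _∙_ ε N (λ i → exponent x i ⋅ var i)

  var-relation : ∀ i → let q = monomial (var i) in
    q 𝔸.* ((q 𝔸.- 𝔸.1#) 𝔸.* (q 𝔸.- 𝔸.1#)) 𝔸.≈ 𝔸.0#
  var-relation i = Ideal⇒∼0 (generator i)

  -- The constant coefficient, that is, the value at q = 0. It is multiplicative because a product
  -- of monomials is trivial exactly when both are.
  atZero : ℙ.Carrier → 𝕂.Carrier
  atZero p = coeff p ε

  δ-ε-∙ : ∀ x y → δ ε (x ∙ y) 𝕂.≈ δ ε x 𝕂.* δ ε y
  δ-ε-∙ x y = 𝕂.trans
    (𝕂.reflexive (≡.cong (if_then 𝕂.1# else 𝕂.0#) (does-⇔ (mk⇔ to from) ((x ∙ y) ≟ᴹᵒ ε) ((x ≟ᴹᵒ ε) ×-dec (y ≟ᴹᵒ ε)))))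
    (if-∧ (does (x ≟ᴹᵒ ε)) (does (y ≟ᴹᵒ ε)))
    where
    to : (x ∙ y) ≈ᴹᵒ ε → x ≈ᴹᵒ ε × y ≈ᴹᵒ ε
    to e = (λ i → ℕ.m+n≡0⇒m≡0 _ (e i)) , (λ i → ℕ.m+n≡0⇒n≡0 (exponent x i) (e i))
    from : x ≈ᴹᵒ ε × y ≈ᴹᵒ ε → (x ∙ y) ≈ᴹᵒ ε
    from (e , f) i = ≡.cong₂ ℕ._+_ (e i) (f i)
    if-∧ : ∀ s t → (if s ∧ t then 𝕂.1# else 𝕂.0#) 𝕂.≈ (if s then 𝕂.1# else 𝕂.0#) 𝕂.* (if t then 𝕂.1# else 𝕂.0#)
    if-∧ true  t = 𝕂.sym (𝕂.*-identityˡ _)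
    if-∧ false t = 𝕂.sym (𝕂.zeroˡ _)

  atZero-* : ∀ p q → atZero (p ℙ.* q) 𝕂.≈ atZero p 𝕂.* atZero q
  atZero-* p q = begin
    coeff (p ℙ.* q) ε                                             ≈⟨ coeff-evaluate (p ℙ.* q) ε ⟩
    evaluate (δ ε) (p ℙ.* q)                                      ≈⟨ evaluate-* (δ ε) p q ⟩
    evaluate (λ x → evaluate (λ y → δ ε (x ∙ y)) q) p
      ≈⟨ evaluate-cong p (λ x → 𝕂.trans (evaluate-cong q (δ-ε-∙ x)) (evaluate-*ˡ (δ ε x) q)) ⟩
    evaluate (λ x → δ ε x 𝕂.* evaluate (δ ε) q) p
      ≈⟨ evaluate-cong p (λ x → 𝕂.*-comm _ _) ⟩
    evaluate (λ x → evaluate (δ ε) q 𝕂.* δ ε x) p                 ≈⟨ evaluate-*ˡ _ p ⟩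
    evaluate (δ ε) q 𝕂.* evaluate (δ ε) p                         ≈⟨ 𝕂.*-comm _ _ ⟩
    evaluate (δ ε) p 𝕂.* evaluate (δ ε) q                         ≈⟨ 𝕂.*-cong (coeff-evaluate p ε) (coeff-evaluate q ε) ⟨
    coeff p ε 𝕂.* coeff q ε                                       ∎
    where
    open import Relation.Binary.Reasoning.Setoid 𝕂.setoid
    open Sums 𝕂.commutativeSemiring
    open CommutativeSemigroupProperties 𝕂.*-commutativeSemigroup
    evaluate-*ˡ : ∀ k {h} p → evaluate (λ x → k 𝕂.* h x) p 𝕂.≈ k 𝕂.* evaluate h p
    evaluate-*ˡ k {h} p = 𝕂.trans (∑-cong p λ (l , x) → x∙yz≈y∙xz l k (h x)) (∑-*ˡ k (λ (l , x) → l 𝕂.* h x) p)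

  atZero-monomial : ∀ x → atZero (monomial x) 𝕂.≈ δ ε x
  atZero-monomial x = 𝕂.+-identityʳ _

  δ-var : ∀ i → δ ε (var i) ≡ 𝕂.0#
  δ-var i = ≡.cong (if_then 𝕂.1# else 𝕂.0#)
    (dec-false (var i ≟ᴹᵒ ε) λ e → contradiction (≡.trans (≡.sym one) (e i)) λ ())
    where
    one : exponent (var i) i ≡ 1
    one = ≡.cong indicator (dec-true (i ℕ.≟ i) ≡.refl)

  -- Every relator has a factor qᵢ, so evaluation at q = 0 descends to the quotient.
  atZero-Ideal : ∀ {p} → Ideal p → atZero p 𝕂.≈ 𝕂.0#
  atZero-Ideal (generator i) = 𝕂.trans (atZero-* q ((q ℙ.- ℙ.1#) ℙ.* (q ℙ.- ℙ.1#)))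
    (𝕂.trans (𝕂.*-congʳ (𝕂.trans (atZero-monomial (var i)) (𝕂.reflexive (δ-var i)))) (𝕂.zeroˡ _))
    where q = monomial (var i)
  atZero-Ideal zero                = 𝕂.refl
  atZero-Ideal (add {p} {q} i j)   = 𝕂.trans (coeff-+ p q ε)
    (𝕂.trans (𝕂.+-cong (atZero-Ideal i) (atZero-Ideal j)) (𝕂.+-identityˡ _))
  atZero-Ideal (multiply r {p} i)  = 𝕂.trans (atZero-* r p) (𝕂.trans (𝕂.*-congˡ (atZero-Ideal i)) (𝕂.zeroʳ _))
  atZero-Ideal (respect e i)       = 𝕂.trans (𝕂.sym (e ε)) (atZero-Ideal i)

  atZero-isHom : IsHomomorphism 𝔸.commutativeSemiring 𝕂.commutativeSemiring atZero
  atZero-isHom = record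
    { isNearSemiringHomomorphism = record
      { +-isMonoidHomomorphism = record
        { isMagmaHomomorphism = record
          { isRelHomomorphism = record { cong = λ {p} {q} → respects p q }
          ; homo = λ p q → coeff-+ p q ε
          }
        ; ε-homo = 𝕂.refl
        }
      ; *-homo = atZero-*
      }
    ; 1#-homo = 𝕂.trans (atZero-monomial ε)
        (𝕂.reflexive (≡.cong (if_then 𝕂.1# else 𝕂.0#) (dec-true (ε ≟ᴹᵒ ε) λ _ → ≡.refl)))
    }
    where
    open import Algebra.Properties.Ring 𝕂.ring using (x∙y⁻¹≈ε⇒x≈y)
    respects : ∀ p q → p 𝔸.≈ q → atZero p 𝕂.≈ atZero q
    respects p q i = x∙y⁻¹≈ε⇒x≈y _ _ (𝕂.trans (𝕂.+-congˡ (𝕂.sym (coeff-neg q ε)))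
      (𝕂.trans (𝕂.sym (coeff-+ p (ℙ.- q) ε)) (atZero-Ideal i)))

-- The two invariants and their kernels.

module Chromatic (K : HeytingField a b c) where
  open AugmentedRing K
  private
    module 𝕂 = CommutativeRing 𝕂
    module 𝔸 = CommutativeRing 𝔸
    module 𝕂∑ = Sums 𝕂.commutativeSemiring
    module 𝔸∑ = Sums 𝔸.commutativeSemiring
    module 𝕂⋆ = Convolution 𝕂.commutativeSemiring
    module 𝔸⋆ = Convolution 𝔸.commutativeSemiring
    module 𝕂W = Weights 𝕂.commutativeSemiring
    module 𝔸W = Weights 𝔸.commutativeSemiring
    module atZero = Homomorphism 𝔸.commutativeSemiring 𝕂.commutativeSemiring atZero atZero-isHom
    module 𝕂-Reasoning = ≈-Reasoning 𝕂.setoid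
    module 𝔸-Reasoning = ≈-Reasoning 𝔸.setoid
  open SemiringMorphisms.IsSemiringHomomorphism atZero-isHom using (⟦⟧-cong; *-homo)
  open RawMonoid monomialMonoid using (ε)

  atZero-cong : ∀ p q → p 𝔸.≈ q → atZero p 𝕂.≈ atZero q
  atZero-cong p q = ⟦⟧-cong {p} {q}

  Ψ̃-expansion : (G : Graph n) (x : Monomial) →
    Ψ̃ K G x 𝔸.≈ 𝔸⋆.⋆< (bound x) (λ i → 𝔸W.weight (monomial (var i)) (exponent x i) (n , G)) (allFin n)
  Ψ̃-expansion {n} G x = ∑-weighted-colourings (monomial ∘ var) G x (λ f → monomial (qᶠ G f)) product
    where
    open ColouringExpansion 𝔸.commutativeSemiring
    open Exponentiation 𝔸.semiring
    product : (f : Colouring n) → (∀ v → f v < bound x) →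
      monomial (qᶠ G f) 𝔸.≈ 𝔸∑.∏< (bound x) (λ i → monomial (var i) ^ monochromatic G f i)
    product f f< = monomial-∏ (bound x) (qᶠ G f) unused
      where
      unused : ∀ j → bound x ≤ j → monochromatic G f j ≡ 0
      unused j N≤j = ≡.trans (≡.sym (edgeCount-colourClass G f j))
        (≡.cong (edgeCount G) (colourClass-unused id f j λ v → ℕ.<⇒≢ (ℕ.<-≤-trans (f< v) N≤j)))

  -- At q = 0 the monomial of a colouring becomes 1 if no edge is monochromatic and 0 otherwise, so
  -- exactly the proper colourings survive.
  Ψ-atZero : (G : Graph n) (x : Monomial) → Ψ K G x 𝕂.≈ atZero (Ψ̃ K G x)
  Ψ-atZero {n} G x = begin
    Ψ K G x
      ≈⟨ 𝕂∑.∑-filter (λ f → proper? G f ×-dec (xᶠ f ≟ᴹᵒ x)) (λ _ → 𝕂.1#) fs ⟩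
    𝕂∑.∑ fs (λ f → if does (proper? G f) ∧ does (xᶠ f ≟ᴹᵒ x) then 𝕂.1# else 𝕂.0#)
      ≈⟨ 𝕂∑.∑-cong fs (λ f → pointwise f (does (xᶠ f ≟ᴹᵒ x))) ⟩
    𝕂∑.∑ fs (λ f → if does (xᶠ f ≟ᴹᵒ x) then atZero (monomial (qᶠ G f)) else 𝕂.0#)
      ≈⟨ 𝕂∑.∑-filter (λ f → U? f ×-dec (xᶠ f ≟ᴹᵒ x)) (λ f → atZero (monomial (qᶠ G f))) fs ⟨
    𝕂∑.∑ (filter (λ f → U? f ×-dec (xᶠ f ≟ᴹᵒ x)) fs) (λ f → atZero (monomial (qᶠ G f)))
      ≈⟨ atZero.homo-∑ (λ f → monomial (qᶠ G f)) (filter (λ f → U? f ×-dec (xᶠ f ≟ᴹᵒ x)) fs) ⟨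
    atZero (Ψ̃ K G x) ∎
    where
    open 𝕂-Reasoning
    fs = colouringsBelow (bound x) n
    proper-ε : ∀ f → does (proper? G f) ≡ does (qᶠ G f ≟ᴹᵒ ε)
    proper-ε f = does-⇔ (proper-⇔ G f) (proper? G f) (qᶠ G f ≟ᴹᵒ ε)
    pointwise : ∀ f t → (if does (proper? G f) ∧ t then 𝕂.1# else 𝕂.0#)
      𝕂.≈ (if t then atZero (monomial (qᶠ G f)) else 𝕂.0#)
    pointwise f true  = 𝕂.trans
      (𝕂.reflexive (≡.cong (if_then 𝕂.1# else 𝕂.0#) (≡.trans (∧-identityʳ _) (proper-ε f))))
      (𝕂.sym (atZero-monomial (qᶠ G f)))
    pointwise f false = 𝕂.reflexive (≡.cong (if_then 𝕂.1# else 𝕂.0#) (∧-zeroʳ (does (proper? G f))))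

  atZero-weight : ∀ i a γ S → atZero (𝔸W.weight (monomial (var i)) a γ S) 𝕂.≈ 𝕂W.weight 𝕂.0# a γ S
  atZero-weight i a γ@(_ , G) S = 𝕂.trans (*-homo (𝔸⋆.size a S) _) (𝕂.*-cong (atZero.homo-size a S)
    (𝕂.trans (atZero.homo-^ (monomial (var i)) (edgeCount G S))
      (^-congˡ (edgeCount G S) (𝕂.trans (atZero-monomial (var i)) (𝕂.reflexive (δ-var i))))))
    where open Exponentiation 𝕂.semiring

  -- Evaluation at q = 0 is applied to the expansion of Ψ̃, which spares a separate count of
  -- partitions into stable sets.
  Ψ-expansion : (G : Graph n) (x : Monomial) →
    Ψ K G x 𝕂.≈ 𝕂⋆.⋆< (bound x) (λ i → 𝕂W.weight 𝕂.0# (exponent x i) (n , G)) (allFin n)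
  Ψ-expansion {n} G x = begin
    Ψ K G x                                          ≈⟨ Ψ-atZero G x ⟩
    atZero (Ψ̃ K G x)
      ≈⟨ atZero-cong (Ψ̃ K G x) (𝔸⋆.⋆< (bound x) φ (allFin n)) (Ψ̃-expansion G x) ⟩
    atZero (𝔸⋆.⋆< (bound x) φ (allFin n))            ≈⟨ atZero.homo-⋆< (bound x) φ (allFin n) ⟩
    𝕂⋆.⋆< (bound x) (λ i → atZero ∘ φ i) (allFin n)
      ≈⟨ 𝕂⋆.⋆<-cong (bound x) (λ i → atZero-weight i (exponent x i) (n , G)) (allFin n) ⟩
    𝕂⋆.⋆< (bound x) (λ i → 𝕂W.weight 𝕂.0# (exponent x i) (n , G)) (allFin n) ∎
    where
    open 𝕂-Reasoning
    φ = λ i → 𝔸W.weight (monomial (var i)) (exponent x i) (n , G)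

  Ψ-linear-∑ : ∀ z x → Ψ-linear K z x ≡ 𝕂∑.∑ z (λ (k , (_ , G)) → k 𝕂.* Ψ K G x)
  Ψ-linear-∑ []                  x = ≡.refl
  Ψ-linear-∑ ((k , (_ , G)) ∷ z) x = ≡.cong (k 𝕂.* Ψ K G x 𝕂.+_) (Ψ-linear-∑ z x)

  Ψ̃-linear-∑ : ∀ z x → Ψ̃-linear K z x 𝔸.≈ 𝔸∑.∑ z (λ (k , (_ , G)) → constant k 𝔸.* Ψ̃ K G x)
  Ψ̃-linear-∑ []                  x = 𝔸.refl {𝔸.0#}
  Ψ̃-linear-∑ ((k , (_ , G)) ∷ z) x = 𝔸.+-cong {k *ₗ Ψ̃ K G x} {constant k 𝔸.* Ψ̃ K G x}
    {Ψ̃-linear K z x} {𝔸∑.∑ z (λ (k , (_ , G)) → constant k 𝔸.* Ψ̃ K G x)}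
    (*ₗ-constant-𝔸 k (Ψ̃ K G x)) (Ψ̃-linear-∑ z x)
    where open RawLeftModule (coefficientModule K) using (_*ₗ_)

  Ψ-linear-atZero : ∀ z x → Ψ-linear K z x 𝕂.≈ atZero (Ψ̃-linear K z x)
  Ψ-linear-atZero z x = begin
    Ψ-linear K z x
      ≡⟨ Ψ-linear-∑ z x ⟩
    𝕂∑.∑ z (λ (k , (_ , G)) → k 𝕂.* Ψ K G x)
      ≈⟨ 𝕂∑.∑-cong z (λ (k , (_ , G)) → 𝕂.*-cong (𝕂.sym (atZero-constant k)) (Ψ-atZero G x)) ⟩
    𝕂∑.∑ z (λ (k , (_ , G)) → atZero (constant k) 𝕂.* atZero (Ψ̃ K G x))
      ≈⟨ 𝕂∑.∑-cong z (λ (k , (_ , G)) → *-homo (constant k) (Ψ̃ K G x)) ⟨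
    𝕂∑.∑ z (λ (k , (_ , G)) → atZero (constant k 𝔸.* Ψ̃ K G x))
      ≈⟨ atZero.homo-∑ (λ (k , (_ , G)) → constant k 𝔸.* Ψ̃ K G x) z ⟨
    atZero (𝔸∑.∑ z (λ (k , (_ , G)) → constant k 𝔸.* Ψ̃ K G x))
      ≈⟨ atZero-cong (Ψ̃-linear K z x) (𝔸∑.∑ z (λ (k , (_ , G)) → constant k 𝔸.* Ψ̃ K G x)) (Ψ̃-linear-∑ z x) ⟨
    atZero (Ψ̃-linear K z x) ∎
    where open 𝕂-Reasoning

  kernel-Ψ̃⊆Ψ : ∀ z → Ker (R̃ K) (Ψ̃-linear K) z → Ker (Λ K) (Ψ-linear K) z
  kernel-Ψ̃⊆Ψ z null x = 𝕂.trans (Ψ-linear-atZero z x) (atZero-cong (Ψ̃-linear K z x) 𝔸.0# (null x))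

  module _ (characteristicZero : CharacteristicZero K) where
    open Multiplication 𝕂.semiring using () renaming (_×_ to _·_)

    -- By tightness it is enough to refute that `x` is apart from 0. In that case `x` would be
    -- invertible, and its inverse would carry (n + 1) x = 0 to n + 1 = 0.
    torsionFree : ∀ n x → (suc n · 𝕂.1#) 𝕂.* x 𝕂.≈ 𝕂.0# → x 𝕂.≈ 𝕂.0#
    torsionFree n x nx≈0 = proj₁ (tight x 𝕂.0#) λ x#0 →
      let y , _ , inverse = #⇒invertible x#0 in
      characteristicZero n (begin
        m                              ≈⟨ 𝕂.*-identityʳ m ⟨
        m 𝕂.* 𝕂.1#                     ≈⟨ 𝕂.*-congˡ inverse ⟨
        -- Invertibility is given for the difference x - 0, which is first simplified to `x`.
        m 𝕂.* ((x 𝕂.- 𝕂.0#) 𝕂.* y)     ≈⟨ 𝕂.*-congˡ (𝕂.*-congʳ (𝕂.trans (𝕂.+-congˡ -0#≈0#) (𝕂.+-identityʳ x))) ⟩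
        m 𝕂.* (x 𝕂.* y)                ≈⟨ 𝕂.*-assoc m x y ⟨
        (m 𝕂.* x) 𝕂.* y                ≈⟨ 𝕂.*-congʳ nx≈0 ⟩
        𝕂.0# 𝕂.* y                     ≈⟨ 𝕂.zeroˡ y ⟩
        𝕂.0#                           ∎)
      where
      open 𝕂-Reasoning
      open HeytingField K using (tight; #⇒invertible)
      open import Algebra.Properties.Ring 𝕂.ring using (-0#≈0#)
      m = suc n · 𝕂.1#

    open Reduction 𝕂.commutativeSemiring 𝔸 constant constant-isHom

    kernel-Ψ⊆Ψ̃ : ∀ z → Ker (Λ K) (Ψ-linear K) z → Ker (R̃ K) (Ψ̃-linear K) z
    kernel-Ψ⊆Ψ̃ z null x = begin
      Ψ̃-linear K z x
        ≈⟨ Ψ̃-linear-∑ z x ⟩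
      𝔸∑.∑ z (λ (k , (_ , G)) → constant k 𝔸.* Ψ̃ K G x)
        ≈⟨ 𝔸∑.∑-cong z (λ (k , (n , G)) → 𝔸.*-congˡ {constant k} {Ψ̃ K G x} {W (n , G) (allFin n)} (Ψ̃-expansion G x)) ⟩
      𝔸∑.∑ z (λ (k , (n , G)) → constant k 𝔸.* W (n , G) (allFin n))
        ≡⟨ 𝔸∑.∑-map (λ (k , (n , G)) → k 𝔸.* W (n , G) (allFin n)) (λ (k , γ) → constant k , γ) z ⟨
      𝔸W.eval constant-z W
        ≈⟨ 𝔸W.eval-cong constant-z {Φ = λ γ → (constant ∘ 𝕂⋆.size 0) 𝔸⋆.⋆ W γ} {Ψ = W} unit ⟨
      𝔸W.eval constant-z (λ γ → (constant ∘ 𝕂⋆.size 0) 𝔸⋆.⋆ W γ)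
        -- The prefix starts as the unit, which is good because all coefficients of Ψ vanish on `z`.
        ≈⟨ vanishing torsionFree z (bound x) (monomial ∘ var) var-relation (exponent x) (λ _ → 𝕂⋆.size 0)
             (good-unit torsionFree z vanishes-0) ⟩
      𝔸.0# ∎
      where
      open 𝔸-Reasoning
      constant-z = map (λ (k , γ) → constant k , γ) z
      W : 𝔸W.Family
      W γ = 𝔸⋆.⋆< (bound x) (λ i → 𝔸W.weight (monomial (var i)) (exponent x i) γ)
      unit : ∀ γ → (constant ∘ 𝕂⋆.size 0) 𝔸⋆.⋆ W γ 𝔸⋆.≋ W γ
      unit γ S = begin
        ((constant ∘ 𝕂⋆.size 0) 𝔸⋆.⋆ W γ) S
          ≈⟨ 𝔸⋆.⋆-cong {φ = constant ∘ 𝕂⋆.size 0} {φ′ = 𝔸⋆.size 0} {ψ = W γ} {ψ′ = W γ}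
               (constant.homo-size 0) (λ S → 𝔸.refl {W γ S}) S ⟩
        (𝔸⋆.size 0 𝔸⋆.⋆ W γ) S
          ≈⟨ 𝔸⋆.⋆-identityˡ (W γ) S ⟩
        W γ S ∎
        where module constant = Homomorphism 𝕂.commutativeSemiring 𝔸.commutativeSemiring constant constant-isHom
      -- The hypothesis is read at every monomial `y`, not only at `x`: the reduction replaces the
      -- exponents of `x` by others.
      vanishes-0 : ∀ y → 𝕂W.eval z (λ γ → 𝕂⋆.⋆< (bound y) (λ i → 𝕂W.weight 𝕂.0# (exponent y i) γ)) 𝕂.≈ 𝕂.0#
      vanishes-0 y = 𝕂.trans (𝕂∑.∑-cong z λ (k , (_ , G)) → 𝕂.*-congˡ (𝕂.sym (Ψ-expansion G y)))
        (𝕂.trans (𝕂.sym (𝕂.reflexive (Ψ-linear-∑ z y))) (null y))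

  difference : ∀ {m n} → Graph m → Graph n → List (𝕂.Carrier × ∃ Graph)
  difference G₁ G₂ = (𝕂.1# , _ , G₁) ∷ (𝕂.- 𝕂.1# , _ , G₂) ∷ []

  Ψ-difference : ∀ {m n} (G₁ : Graph m) (G₂ : Graph n) x →
    Ψ-linear K (difference G₁ G₂) x 𝕂.≈ Ψ K G₁ x 𝕂.- Ψ K G₂ x
  Ψ-difference G₁ G₂ x = 𝕂.+-cong (𝕂.*-identityˡ _) (𝕂.trans (𝕂.+-identityʳ _) (-1*x≈-x _))
    where open import Algebra.Properties.Ring 𝕂.ring using (-1*x≈-x)

  Ψ̃-difference : ∀ {m n} (G₁ : Graph m) (G₂ : Graph n) x →
    Ψ̃-linear K (difference G₁ G₂) x 𝔸.≈ Ψ̃ K G₁ x 𝔸.- Ψ̃ K G₂ x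
  Ψ̃-difference G₁ G₂ x = begin
    Ψ̃-linear K (difference G₁ G₂) x
      ≈⟨ Ψ̃-linear-∑ (difference G₁ G₂) x ⟩
    𝔸.1# 𝔸.* s₁ 𝔸.+ ((𝔸.- 𝔸.1#) 𝔸.* s₂ 𝔸.+ 𝔸.0#)
      ≈⟨ 𝔸.+-cong {𝔸.1# 𝔸.* s₁} {s₁} {(𝔸.- 𝔸.1#) 𝔸.* s₂ 𝔸.+ 𝔸.0#} {(𝔸.- 𝔸.1#) 𝔸.* s₂}
           (𝔸.*-identityˡ s₁) (𝔸.+-identityʳ ((𝔸.- 𝔸.1#) 𝔸.* s₂)) ⟩
    s₁ 𝔸.+ (𝔸.- 𝔸.1#) 𝔸.* s₂
      ≈⟨ 𝔸.+-congˡ {s₁} {(𝔸.- 𝔸.1#) 𝔸.* s₂} {𝔸.- s₂} (-1*x≈-x s₂) ⟩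
    s₁ 𝔸.- s₂ ∎
    where
    open 𝔸-Reasoning
    open import Algebra.Properties.Ring 𝔸.ring using (-1*x≈-x)
    s₁ = Ψ̃ K G₁ x
    s₂ = Ψ̃ K G₂ x

proposition18 : ∀ {c ℓ₁ ℓ₂} (K : HeytingField c ℓ₁ ℓ₂) → CharacteristicZero K →
    (Ker (R̃ K) (Ψ̃-linear K) ≐ Ker (Λ K) (Ψ-linear K))
    × (∀ {m n} (G₁ : Graph m) (G₂ : Graph n) →
    RawLeftModule._≈ᴹ_ (Λ K) (Ψ K G₁) (Ψ K G₂)
    ⇔ RawLeftModule._≈ᴹ_ (R̃ K) (Ψ̃ K G₁) (Ψ̃ K G₂))
proposition18 K characteristicZero =
  ((λ {z} → kernel-Ψ̃⊆Ψ z) , (λ {z} → kernel-Ψ⊆Ψ̃ characteristicZero z)) , λ G₁ G₂ → mk⇔ (to G₁ G₂) (from G₁ G₂)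
  where
  open Chromatic K
  open AugmentedRing K
  module 𝕂 = CommutativeRing 𝕂
  module 𝔸 = CommutativeRing 𝔸
  open import Algebra.Properties.Ring 𝕂.ring using (x∙y⁻¹≈ε⇒x≈y; x≈y⇒x∙y⁻¹≈ε)
  module 𝔸-Properties = Algebra.Properties.Ring 𝔸.ring
  -- Kernel inclusion is applied to the formal difference of the two graphs.
  to : ∀ {m n} (G₁ : Graph m) (G₂ : Graph n) → (∀ x → Ψ K G₁ x 𝕂.≈ Ψ K G₂ x) → ∀ x → Ψ̃ K G₁ x 𝔸.≈ Ψ̃ K G₂ x
  to G₁ G₂ e x = 𝔸-Properties.x∙y⁻¹≈ε⇒x≈y (Ψ̃ K G₁ x) (Ψ̃ K G₂ x)
    (𝔸.trans {Ψ̃ K G₁ x 𝔸.- Ψ̃ K G₂ x} {Ψ̃-linear K z x} {𝔸.0#}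
      (𝔸.sym {Ψ̃-linear K z x} {Ψ̃ K G₁ x 𝔸.- Ψ̃ K G₂ x} (Ψ̃-difference G₁ G₂ x))
      (kernel-Ψ⊆Ψ̃ characteristicZero z (λ y → 𝕂.trans (Ψ-difference G₁ G₂ y) (x≈y⇒x∙y⁻¹≈ε (e y))) x))
    where z = difference G₁ G₂
  -- This direction is evaluation at q = 0, coefficient by coefficient, on each graph alone.
  from : ∀ {m n} (G₁ : Graph m) (G₂ : Graph n) → (∀ x → Ψ̃ K G₁ x 𝔸.≈ Ψ̃ K G₂ x) → ∀ x → Ψ K G₁ x 𝕂.≈ Ψ K G₂ x
  from G₁ G₂ e x = 𝕂.trans (Ψ-atZero G₁ x)
    (𝕂.trans (atZero-cong (Ψ̃ K G₁ x) (Ψ̃ K G₂ x) (e x)) (𝕂.sym (Ψ-atZero G₂ x)))
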